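{- For every fixed graph $H$ there exists a constant $0<c_H<1$ such that if $e\ge c_H\binom{n}{2}$, then among graphs with $n$ vertices and $e$ edges the number of subgraphs isomorphic to $H$ is asymptotically maximized by the quasi-clique, i.e. $$ex(n,e,H)=(1+o(1))\,N(H,K^e_n)\qquad (n\to\infty).$$
   Context: For graphs $H,G$, $N(H,G)$ denotes the number of (not necessarily induced) subgraphs of $G$ isomorphic to $H$. $ex(n,e,H)=\max\{N(H,G): |V(G)|=n,\ |E(G)|=e\}$. For $0\le e\le\binom n2$ write $e=\binom{a}{2}+b$ with $0\le b<a$; the quasi-clique $K^e_n$ is the $n$-vertex graph consisting of a clique on $a$ vertices, one further vertex joined to exactly $b$ vertices of this clique, and $n-a-1$ isolated vertices (so it has $e$ edges). -}

module Defs where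

open import Data.Bool using (Bool; true; false; not; _∧_; _∨_; _xor_; if_then_else_)
open import Data.Nat using (ℕ; zero; suc; _⊔_; _≡ᵇ_; _<ᵇ_)
open import Data.Fin using (Fin; toℕ)
open import Data.List using (List; []; _∷_; map; concatMap; allFin; length; filterᵇ; foldr; cartesianProduct)
open import Data.Bool.ListAction using (all; any)
open import Data.Product using (_×_; _,_)
open import Data.Integer using (+_)
open import Data.Rational using (ℚ; _/_)
import Data.Vec.Functional as VF
open import Relation.Binary.PropositionalEquality using (_≡_)

record SimpleGraph (n : ℕ) : Set where
  field
    adj    : Fin n → Fin n → Bool
    sym    : ∀ i j → adj i j ≡ adj j i
    irrefl : ∀ i → adj i i ≡ false
open SimpleGraph public

Adj : ℕ → Set
Adj n = Fin n → Fin n → Bool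

_==ᵇ_ : Bool → Bool → Bool
a ==ᵇ b = not (a xor b)

_⇒ᵇ_ : Bool → Bool → Bool
a ⇒ᵇ b = not a ∨ b

_=F_ : ∀ {n} → Fin n → Fin n → Bool
i =F j = toℕ i ≡ᵇ toℕ j

allV : (n : ℕ) → (Fin n → Bool) → Bool
allV n p = all p (allFin n)

anyV : (n : ℕ) → (Fin n → Bool) → Bool
anyV n p = any p (allFin n)

count : ∀ {A : Set} → (A → Bool) → List A → ℕ
count p xs = length (filterᵇ p xs)

enum : ∀ {A : Set} → List A → (m : ℕ) → List (Fin m → A)
enum xs zero    = (λ ()) ∷ []
enum xs (suc m) = concatMap (λ f → map (λ x → x VF.∷ f) xs) (enum xs m)

bools : List Bool
bools = true ∷ false ∷ []

subsets : (n : ℕ) → List (Fin n → Bool)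
subsets n = enum bools n

matrices : (n : ℕ) → List (Adj n)
matrices n = enum (subsets n) n

maps : (k n : ℕ) → List (Fin k → Fin n)
maps k n = enum (allFin n) k

isSimple : ∀ n → Adj n → Bool
isSimple n A = allV n (λ i → allV n (λ j → A i j ==ᵇ A j i)) ∧ allV n (λ i → not (A i i))

edges : ∀ n → Adj n → ℕ
edges n A = count (λ { (i , j) → (toℕ i <ᵇ toℕ j) ∧ A i j }) (cartesianProduct (allFin n) (allFin n))

isSubgraph : ∀ n → Adj n → (Fin n → Bool) → Adj n → Bool
isSubgraph n G W F =
  isSimple n F ∧ allV n (λ i → allV n (λ j → F i j ⇒ᵇ (G i j ∧ W i ∧ W j)))

isoTo : ∀ {k} n → SimpleGraph k → (Fin n → Bool) → Adj n → Bool
isoTo {k} n H W F = any ok (maps k n)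
  where
  ok : (Fin k → Fin n) → Bool
  ok f = allV k (λ i → allV k (λ j → (f i =F f j) ⇒ᵇ (i =F j)))
       ∧ allV n (λ v → W v ==ᵇ anyV k (λ i → f i =F v))
       ∧ allV k (λ i → allV k (λ j → F (f i) (f j) ==ᵇ adj H i j))

NH : ∀ {k} n → SimpleGraph k → Adj n → ℕ
NH n H G = count (λ { (W , F) → isSubgraph n G W F ∧ isoTo n H W F })
                 (cartesianProduct (subsets n) (matrices n))

ex : ∀ {k} → ℕ → ℕ → SimpleGraph k → ℕ
ex n e H = foldr _⊔_ 0 (map (NH n H)
             (filterᵇ (λ G → isSimple n G ∧ (edges n G ≡ᵇ e)) (matrices n)))

-- Quasi-clique K^e_n for e = C(a,2) + b, 0 ≤ b < a:
-- clique on vertices 0..a-1, vertex a joined to vertices 0..b-1, the rest isolated.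
quasiClique : (n a b : ℕ) → Adj n
quasiClique n a b i j =
  not (i =F j) ∧
  (((toℕ i <ᵇ a) ∧ (toℕ j <ᵇ a))
   ∨ ((toℕ j ≡ᵇ a) ∧ (toℕ i <ᵇ b))
   ∨ ((toℕ i ≡ᵇ a) ∧ (toℕ j <ᵇ b)))

ℕtoℚ : ℕ → ℚ
ℕtoℚ m = + m / 1

{-# OPTIONS --safe #-}

-- Counting pairs (copy of H, isomorphism onto it) gives NH · |Aut H| = number of injective homomorphisms,
-- so injective homomorphisms may be compared instead.  The non-isolated vertices of H can be covered by
-- vertex-disjoint stars K_{1,r} ⊆ H with r ≥ 1, hence a graph G has at most n^i · ∏ Σ_v d(v)^r of them, with i
-- the number of isolated vertices of H.  For edge density close to 1 one has Σ_v d(v)^r ≤ (2e)^((r+1)/2):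
-- delete vertices of degree ≤ (1 − δ) n one at a time, each of which costs less of the left-hand side than of
-- the right-hand side; when none is left, all degrees are near n and the bound is the first-order
-- expansion at the complete graph.  As 2e ≤ (a+1)², G has at most n^i (a+1)^m injective homomorphisms
-- (m = k − i), while the quasi-clique has at least (n−k)^i (a−k)^m, and the ratio tends to 1.
module Submission where

open import Defs
open import Data.Nat using (ℕ; _≤_; _<_)
open import Data.Nat.Combinatorics using (_C_)
open import Data.Nat.Base using (_+_)
open import Data.Rational using (ℚ; 0ℚ; 1ℚ; _-_; _*_) renaming (_+_ to _+ℚ_; _≤_ to _≤ℚ_; _<_ to _<ℚ_)
open import Data.Product using (Σ; _×_; ∃)

open import Data.Bool using (Bool; true; false; not; _∧_; _∨_; if_then_else_)
open import Data.Bool.ListAction using (all; any)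
open import Data.Bool.Properties using (∧-comm; ∨-comm; T-≡)
open import Data.Empty using (⊥-elim)
open import Data.Fin using (Fin; zero; suc; toℕ; fromℕ<)
open import Data.Fin.Properties using (toℕ-injective; toℕ-fromℕ<; toℕ<n)
open import Data.Integer as ℤ using (-[1+_]; +≤+; +<+) renaming (+_ to +ᶻ_)
import Data.Integer.Properties as ℤₚ
open import Data.List using (List; []; _∷_; _++_; map; concatMap; allFin; length; filterᵇ; foldr; cartesianProduct)
open import Data.List.Membership.Propositional using (_∈_; find)
open import Data.List.Membership.Propositional.Properties using (∈-∃++; ∈-++⁻; ∈-++⁺ˡ; ∈-++⁺ʳ; ∈-map⁻; ∈-tabulate⁺)
open import Data.List.Properties using (map-tabulate; map-∘; map-id; length-tabulate; length-++; ++-assoc)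
open import Data.List.Relation.Binary.Permutation.Propositional using (_↭_; prep; swap; ↭-sym; ↭-trans; ↭-reflexive)
import Data.List.Relation.Binary.Permutation.Propositional as Perm
open import Data.List.Relation.Binary.Permutation.Propositional.Properties using (shift; ↭-length; ∈-resp-↭; ++-comm; ++⁺ʳ)
open import Data.List.Relation.Unary.All as All using (All; []; _∷_; all?; lookup)
open import Data.List.Relation.Unary.All.Properties using (¬All⇒Any¬)
open import Data.List.Relation.Unary.Any using (here; there)
import Data.Nat as ℕ
open import Data.Nat using (zero; suc; z≤n; s≤s; _≤?_; _∸_; _⊔_; _≡ᵇ_; _<ᵇ_; _^_) renaming (_*_ to _·_)
open import Data.Nat.Combinatorics using (nC1≡n; nCk+nC[k+1]≡[n+1]C[k+1])
open import Data.Nat.Coprimality using (Coprime)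
import Data.Nat.Properties as ℕₚ
open import Data.Nat.Tactic.RingSolver using (solve-∀)
open import Data.Product using (∃₂; _,_; proj₁; proj₂)
import Data.Rational as ℚ
open import Data.Rational using (toℚᵘ; fromℚᵘ)
import Data.Rational.Properties as ℚₚ
open import Data.Rational.Unnormalised as ℚᵘ using (mkℚᵘ; *≤*; *<*)
import Data.Rational.Unnormalised.Properties as ℚᵘₚ
open import Data.Sum using (_⊎_; inj₁; inj₂)
import Data.Vec.Functional as VF
open import Function using (_∘_; id; Equivalence)
open import Relation.Binary.Definitions using (tri<; tri≈; tri>)
open import Relation.Binary.PropositionalEquality using (_≡_; _≢_; refl; trans; cong; cong₂; subst; subst₂; module ≡-Reasoning) renaming (sym to ≡sym)
open import Relation.Nullary using (yes; no)

-- The star cover is asymptotically lossless: a star with r leaves contributes (2e)^((r+1)/2), a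
-- factor sqrt(2e) for each of its r + 1 vertices, and in a clique on a vertices, where 2e is about
-- a², that many free choices really exist; edges of `H` outside the stars cost nothing there. Some
-- density is unavoidable for the star inequality: K_{1,n-1} has Σ d(v)² = n(n - 1), far above
-- (2e)^(3/2) for large n. The inequality is asymptotically tight for every clique with isolated
-- vertices added, so near-extremal graphs may have linearly many vertices of small degree, and an
-- expansion around the complete graph on all n vertices does not reach them; this forces the
-- deletion. Since linearly many vertices may go, no error can be afforded per step: the inequality
-- is kept exact, and squared, which makes its exponent r + 1 integral.

private variable
  A B : Set

-- Finite sums and products

∑ : List A → (A → ℕ) → ℕ
∑ []       f = 0
∑ (x ∷ xs) f = f x + ∑ xs f

∏ : List A → (A → ℕ) → ℕ
∏ []       f = 1
∏ (x ∷ xs) f = f x · ∏ xs f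

infixr 5 ∑ ∏
syntax ∑ xs (λ x → e) = ∑[ x ← xs ] e
syntax ∏ xs (λ x → e) = ∏[ x ← xs ] e

𝟙 : Bool → ℕ
𝟙 true  = 1
𝟙 false = 0

∑-cong : ∀ (xs : List A) {f g} → (∀ x → f x ≡ g x) → ∑ xs f ≡ ∑ xs g
∑-cong []       f≡g = refl
∑-cong (x ∷ xs) f≡g = cong₂ _+_ (f≡g x) (∑-cong xs f≡g)

∑-mono-∈ : ∀ (xs : List A) {f g} → (∀ {x} → x ∈ xs → f x ≤ g x) → ∑ xs f ≤ ∑ xs g
∑-mono-∈ []       f≤g = z≤n
∑-mono-∈ (x ∷ xs) f≤g = ℕₚ.+-mono-≤ (f≤g (here refl)) (∑-mono-∈ xs (f≤g ∘ there))

∑-mono : ∀ (xs : List A) {f g} → (∀ x → f x ≤ g x) → ∑ xs f ≤ ∑ xs g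
∑-mono xs f≤g = ∑-mono-∈ xs (λ {x} _ → f≤g x)

∑-++ : ∀ (xs ys : List A) f → ∑ (xs ++ ys) f ≡ ∑ xs f + ∑ ys f
∑-++ []       ys f = refl
∑-++ (x ∷ xs) ys f = trans (cong (f x +_) (∑-++ xs ys f)) (≡sym (ℕₚ.+-assoc (f x) _ _))

∑-map : ∀ (g : A → B) xs f → ∑ (map g xs) f ≡ ∑ xs (f ∘ g)
∑-map g []       f = refl
∑-map g (x ∷ xs) f = cong (f (g x) +_) (∑-map g xs f)

∑-concatMap : ∀ (g : A → List B) xs f → ∑ (concatMap g xs) f ≡ ∑[ x ← xs ] ∑ (g x) f
∑-concatMap g []       f = refl
∑-concatMap g (x ∷ xs) f =
  trans (∑-++ (g x) _ f) (cong (∑ (g x) f +_) (∑-concatMap g xs f))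

∑-+ : ∀ (xs : List A) f g → ∑[ x ← xs ] (f x + g x) ≡ ∑ xs f + ∑ xs g
∑-+ []       f g = refl
∑-+ (x ∷ xs) f g = trans (cong (f x + g x +_) (∑-+ xs f g)) (lemma (f x) (g x) _ _)
  where
  lemma : ∀ a b c d → a + b + (c + d) ≡ a + c + (b + d)
  lemma = solve-∀

∑-*ʳ : ∀ (xs : List A) f c → ∑[ x ← xs ] (f x · c) ≡ ∑ xs f · c
∑-*ʳ []       f c = refl
∑-*ʳ (x ∷ xs) f c = trans (cong (f x · c +_) (∑-*ʳ xs f c)) (≡sym (ℕₚ.*-distribʳ-+ c (f x) _))

∑-*ˡ : ∀ (xs : List A) c f → ∑[ x ← xs ] (c · f x) ≡ c · ∑ xs f
∑-*ˡ xs c f = trans (∑-cong xs (λ x → ℕₚ.*-comm c (f x))) (trans (∑-*ʳ xs f c) (ℕₚ.*-comm _ c))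

∑-const : ∀ (xs : List A) c → ∑[ _ ← xs ] c ≡ length xs · c
∑-const []       c = refl
∑-const (x ∷ xs) c = cong (c +_) (∑-const xs c)

∑-zero : ∀ (xs : List A) {f} → (∀ x → f x ≡ 0) → ∑ xs f ≡ 0
∑-zero xs f≡0 = trans (∑-cong xs f≡0) (trans (∑-const xs 0) (ℕₚ.*-zeroʳ (length xs)))

∑-swap : ∀ (xs : List A) (ys : List B) (f : A → B → ℕ) →
  ∑[ x ← xs ] ∑[ y ← ys ] f x y ≡ ∑[ y ← ys ] ∑[ x ← xs ] f x y
∑-swap []       ys f = ≡sym (∑-zero ys (λ _ → refl))
∑-swap (x ∷ xs) ys f =
  trans (cong (∑ ys (f x) +_) (∑-swap xs ys f)) (≡sym (∑-+ ys (f x) _))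

∑-↭ : ∀ {xs ys : List A} → xs ↭ ys → ∀ f → ∑ xs f ≡ ∑ ys f
∑-↭ Perm.refl        f = refl
∑-↭ (prep x p)       f = cong (f x +_) (∑-↭ p f)
∑-↭ (swap x y p)     f = trans (cong (λ s → f x + (f y + s)) (∑-↭ p f)) (lemma (f x) (f y) _)
  where
  lemma : ∀ a b c → a + (b + c) ≡ b + (a + c)
  lemma = solve-∀
∑-↭ (Perm.trans p q) f = trans (∑-↭ p f) (∑-↭ q f)

∏-↭ : ∀ {xs ys : List A} → xs ↭ ys → ∀ f → ∏ xs f ≡ ∏ ys f
∏-↭ Perm.refl        f = refl
∏-↭ (prep x p)       f = cong (f x ·_) (∏-↭ p f)
∏-↭ (swap x y p)     f = trans (cong (λ s → f x · (f y · s)) (∏-↭ p f)) (lemma (f x) (f y) _)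
  where
  lemma : ∀ a b c → a · (b · c) ≡ b · (a · c)
  lemma = solve-∀
∏-↭ (Perm.trans p q) f = trans (∏-↭ p f) (∏-↭ q f)

∏-++ : ∀ (xs ys : List A) f → ∏ (xs ++ ys) f ≡ ∏ xs f · ∏ ys f
∏-++ []       ys f = ≡sym (ℕₚ.+-identityʳ _)
∏-++ (x ∷ xs) ys f = trans (cong (f x ·_) (∏-++ xs ys f)) (≡sym (ℕₚ.*-assoc (f x) _ _))

∏-map : ∀ (g : A → B) xs f → ∏ (map g xs) f ≡ ∏ xs (f ∘ g)
∏-map g []       f = refl
∏-map g (x ∷ xs) f = cong (f (g x) ·_) (∏-map g xs f)

∏-mono : ∀ (xs : List A) {f g} → (∀ x → f x ≤ g x) → ∏ xs f ≤ ∏ xs g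
∏-mono []       f≤g = ℕₚ.≤-refl
∏-mono (x ∷ xs) f≤g = ℕₚ.*-mono-≤ (f≤g x) (∏-mono xs f≤g)

∏-const : ∀ (xs : List A) c → ∏[ _ ← xs ] c ≡ c ^ length xs
∏-const []       c = refl
∏-const (x ∷ xs) c = cong (c ·_) (∏-const xs c)

∏-* : ∀ (xs : List A) f g → ∏[ x ← xs ] (f x · g x) ≡ ∏ xs f · ∏ xs g
∏-* []       f g = refl
∏-* (x ∷ xs) f g = trans (cong (f x · g x ·_) (∏-* xs f g)) (lemma (f x) (g x) _ _)
  where
  lemma : ∀ a b c d → a · b · (c · d) ≡ a · c · (b · d)
  lemma = solve-∀

count≡∑ : ∀ (p : A → Bool) xs → count p xs ≡ ∑[ x ← xs ] 𝟙 (p x)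
count≡∑ p [] = refl
count≡∑ p (x ∷ xs) with p x
... | true  = cong suc (count≡∑ p xs)
... | false = count≡∑ p xs

count-× : ∀ (p : A × B → Bool) xs ys →
  count p (cartesianProduct xs ys) ≡ ∑[ x ← xs ] ∑[ y ← ys ] 𝟙 (p (x , y))
count-× p xs ys = trans (count≡∑ p (cartesianProduct xs ys)) (go xs)
  where
  go : ∀ xs → ∑ (cartesianProduct xs ys) (𝟙 ∘ p) ≡ ∑[ x ← xs ] ∑[ y ← ys ] 𝟙 (p (x , y))
  go []       = refl
  go (x ∷ xs) = trans (∑-++ (map (x ,_) ys) _ _) (cong₂ _+_ (∑-map (x ,_) ys _) (go xs))

allFin-suc : ∀ n → allFin (suc n) ≡ zero ∷ map suc (allFin n)
allFin-suc n = cong (zero ∷_) (≡sym (map-tabulate id suc))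

∑-allFin-suc : ∀ n f → ∑ (allFin (suc n)) f ≡ f zero + ∑ (allFin n) (f ∘ suc)
∑-allFin-suc n f = trans (cong (λ xs → ∑ xs f) (allFin-suc n)) (cong (f zero +_) (∑-map suc (allFin n) f))

∏-allFin-suc : ∀ n f → ∏ (allFin (suc n)) f ≡ f zero · ∏ (allFin n) (f ∘ suc)
∏-allFin-suc n f = trans (cong (λ xs → ∏ xs f) (allFin-suc n)) (cong (f zero ·_) (∏-map suc (allFin n) f))

∑-enum-suc : ∀ (xs : List A) m Φ →
  ∑ (enum xs (suc m)) Φ ≡ ∑[ f ← enum xs m ] ∑[ x ← xs ] Φ (x VF.∷ f)
∑-enum-suc xs m Φ = trans (∑-concatMap (λ f → map (VF._∷ f) xs) (enum xs m) Φ)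
                          (∑-cong (enum xs m) (λ f → ∑-map (VF._∷ f) xs Φ))

-- Boolean predicates

true≢false : ∀ {b} → b ≡ true → b ≢ false
true≢false refl ()

bool-ext : ∀ {a b} → (a ≡ true → b ≡ true) → (b ≡ true → a ≡ true) → a ≡ b
bool-ext {true}  {b}     f g = ≡sym (f refl)
bool-ext {false} {true}  f g = g refl
bool-ext {false} {false} f g = refl

not-true : ∀ {b} → (b ≢ true) → b ≡ false
not-true {true}  b≢ = ⊥-elim (b≢ refl)
not-true {false} b≢ = refl

∧-intro : ∀ {a b} → a ≡ true → b ≡ true → a ∧ b ≡ true
∧-intro refl refl = refl

∧-elim : ∀ {a b} → a ∧ b ≡ true → (a ≡ true) × (b ≡ true)
∧-elim {true} {true} refl = refl , refl

⇒ᵇ-intro : ∀ {a b} → (a ≡ true → b ≡ true) → (a ⇒ᵇ b) ≡ true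
⇒ᵇ-intro {true}  f = f refl
⇒ᵇ-intro {false} f = refl

⇒ᵇ-elim : ∀ {a b} → (a ⇒ᵇ b) ≡ true → a ≡ true → b ≡ true
⇒ᵇ-elim p refl = p

==ᵇ-intro : ∀ {a b} → a ≡ b → (a ==ᵇ b) ≡ true
==ᵇ-intro {true}  refl = refl
==ᵇ-intro {false} refl = refl

==ᵇ-elim : ∀ {a b} → (a ==ᵇ b) ≡ true → a ≡ b
==ᵇ-elim {true}  {true}  refl = refl
==ᵇ-elim {false} {false} refl = refl

=F-refl : ∀ {n} (i : Fin n) → (i =F i) ≡ true
=F-refl zero    = refl
=F-refl (suc i) = =F-refl i

=F-intro : ∀ {n} {i j : Fin n} → i ≡ j → (i =F j) ≡ true
=F-intro {i = i} refl = =F-refl i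

=F-elim : ∀ {n} {i j : Fin n} → (i =F j) ≡ true → i ≡ j
=F-elim {i = zero}  {zero}  refl = refl
=F-elim {i = suc i} {suc j} p    = cong suc (=F-elim p)

allV-suc : ∀ n p → allV (suc n) p ≡ p zero ∧ allV n (p ∘ suc)
allV-suc n p = cong (p zero ∧_) (cong (foldr _∧_ true)
  (trans (map-tabulate suc p) (≡sym (map-tabulate id (p ∘ suc)))))

allV-intro : ∀ n {p} → (∀ i → p i ≡ true) → allV n p ≡ true
allV-intro zero    h = refl
allV-intro (suc n) {p} h = trans (allV-suc n p) (∧-intro (h zero) (allV-intro n (h ∘ suc)))

allV-elim : ∀ n {p} → allV n p ≡ true → ∀ i → p i ≡ true
allV-elim (suc n) {p} h zero    = proj₁ (∧-elim (trans (≡sym (allV-suc n p)) h))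
allV-elim (suc n) {p} h (suc i) = allV-elim n (proj₂ (∧-elim {p zero} (trans (≡sym (allV-suc n p)) h))) i

any-elim : ∀ {p : A → Bool} xs → any p xs ≡ true → ∃ λ x → (x ∈ xs) × (p x ≡ true)
any-elim {p = p} (x ∷ xs) h with p x in eq
... | true  = x , here refl , eq
... | false = let y , y∈ , py = any-elim xs h in y , there y∈ , py

any-intro : ∀ {p : A → Bool} {x} xs → x ∈ xs → p x ≡ true → any p xs ≡ true
any-intro {p = p} (x ∷ xs) (here refl) px rewrite px = refl
any-intro {p = p} (x ∷ xs) (there x∈) px with p x
... | true  = refl
... | false = any-intro xs x∈ px

∈-allFin : ∀ {n} (i : Fin n) → i ∈ allFin n
∈-allFin i = ∈-tabulate⁺ i

anyV-elim : ∀ n {p} → anyV n p ≡ true → ∃ λ i → p i ≡ true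
anyV-elim n h = let i , _ , pi = any-elim (allFin n) h in i , pi

anyV-intro : ∀ n {p} i → p i ≡ true → anyV n p ≡ true
anyV-intro n i pi = any-intro (allFin n) (∈-allFin i) pi

𝟙-mono : ∀ {a b} → (a ≡ true → b ≡ true) → 𝟙 a ≤ 𝟙 b
𝟙-mono {true}  f rewrite f refl = ℕₚ.≤-refl
𝟙-mono {false} f = z≤n

𝟙≤1 : ∀ b → 𝟙 b ≤ 1
𝟙≤1 true  = ℕₚ.≤-refl
𝟙≤1 false = z≤n

𝟙-∧ : ∀ a b → 𝟙 (a ∧ b) ≡ 𝟙 a · 𝟙 b
𝟙-∧ true  b = ≡sym (ℕₚ.+-identityʳ _)
𝟙-∧ false b = refl

∑𝟙-none : ∀ {p : A → Bool} xs → any p xs ≡ false → ∑[ x ← xs ] 𝟙 (p x) ≡ 0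
∑𝟙-none []       h = refl
∑𝟙-none {p = p} (x ∷ xs) h with p x
... | false = ∑𝟙-none xs h

∑𝟙-some : ∀ {p : A → Bool} xs → 0 < ∑[ x ← xs ] 𝟙 (p x) → ∃ λ x → (x ∈ xs) × (p x ≡ true)
∑𝟙-some {p = p} xs h with any p xs in eq
... | true  = any-elim xs eq
... | false = ⊥-elim (ℕₚ.<-irrefl (≡sym (∑𝟙-none xs eq)) h)

-- Powers of naturals

-- l ≤ r follows from x ≤ y by adding slack p; the side condition is a semiring identity, so the solver proves it.
≤-cancel : ∀ {l r x y p} → x ≤ y → l + y + p ≡ r + x → l ≤ r
≤-cancel {l} {r} {x} {y} {p} x≤y eq = ℕₚ.+-cancelʳ-≤ y l r (begin
  l + y      ≤⟨ ℕₚ.m≤m+n (l + y) p ⟩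
  l + y + p  ≡⟨ eq ⟩
  r + x      ≤⟨ ℕₚ.+-monoʳ-≤ r x≤y ⟩
  r + y      ∎)
  where open ℕₚ.≤-Reasoning

-- The tangent of t^(m+1) at x lies below the power. Together with `^-upper` this stands in for
-- calculus.
^-lower : ∀ m x y → x ^ suc m + suc m · y · x ^ m ≤ (x + y) ^ suc m
^-lower zero    x y = ℕₚ.≤-reflexive (lemma x y)
  where
  lemma : ∀ x y → x · 1 + 1 · y · 1 ≡ (x + y) · 1
  lemma = solve-∀
^-lower (suc m) x y = ≤-cancel (ℕₚ.*-monoʳ-≤ (x + y) (^-lower m x y)) (lemma m x y (x ^ m) ((x + y) ^ suc m))
  where
  lemma : ∀ m x y a b →
    x · (x · a) + suc (suc m) · y · (x · a) + (x + y) · b + suc m · y · y · a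
    ≡ (x + y) · b + (x + y) · (x · a + suc m · y · a)
  lemma = solve-∀

-- Convexity again, with the tangent at the right end x + y; its linear term is moved to the right
-- so that no subtraction occurs.
^-upper : ∀ m x y → (x + y) ^ suc m ≤ x ^ suc m + suc m · y · (x + y) ^ m
^-upper zero    x y = ℕₚ.≤-reflexive (lemma x y)
  where
  lemma : ∀ x y → (x + y) · 1 ≡ x · 1 + 1 · y · 1
  lemma = solve-∀
^-upper (suc m) x y =
  ≤-cancel (ℕₚ.*-monoʳ-≤ x (^-upper m x y)) (lemma m x y (x ^ m) ((x + y) ^ m))
  where
  lemma : ∀ m x y a b →
    (x + y) · ((x + y) · b) + x · (x · a + suc m · y · b) + suc m · y · y · b
    ≡ x · (x · a) + suc (suc m) · y · ((x + y) · b) + x · ((x + y) · b)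
  lemma = solve-∀

^-distrib-· : ∀ m x y → (x · y) ^ m ≡ x ^ m · y ^ m
^-distrib-· zero    x y = refl
^-distrib-· (suc m) x y = trans (cong (x · y ·_) (^-distrib-· m x y)) (lemma x y (x ^ m) (y ^ m))
  where
  lemma : ∀ x y a b → x · y · (a · b) ≡ x · a · (y · b)
  lemma = solve-∀

2xy≤x²+y² : ∀ x y → 2 · (x · y) ≤ x · x + y · y
2xy≤x²+y² zero    y       = z≤n
2xy≤x²+y² (suc x) zero    = subst (_≤ suc x · suc x + 0) (≡sym (cong (2 ·_) (ℕₚ.*-zeroʳ (suc x)))) z≤n
2xy≤x²+y² (suc x) (suc y) = ≤-cancel (2xy≤x²+y² x y) (lemma x y)
  where
  lemma : ∀ x y → 2 · (suc x · suc y) + (x · x + y · y) + 0 ≡ suc x · suc x + suc y · suc y + 2 · (x · y)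
  lemma = solve-∀

²-cancel-≤ : ∀ {x y} → x · x ≤ y · y → x ≤ y
²-cancel-≤ {x} {y} x²≤y² = ℕₚ.≮⇒≥ (λ y<x → ℕₚ.<⇒≱ (ℕₚ.*-mono-< y<x y<x) x²≤y²)

∑-cauchy-schwarz : ∀ (xs : List A) f → ∑ xs f · ∑ xs f ≤ length xs · (∑[ x ← xs ] (f x · f x))
∑-cauchy-schwarz []       f = z≤n
∑-cauchy-schwarz (x ∷ xs) f =
  ≤-cancel (ℕₚ.+-mono-≤ (∑-cauchy-schwarz xs f) cross) (lemma (f x) (∑ xs f) (length xs) _)
  where
  open ℕₚ.≤-Reasoning
  cross : 2 · (f x · ∑ xs f) ≤ length xs · (f x · f x) + (∑[ y ← xs ] (f y · f y))
  cross = begin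
    2 · (f x · ∑ xs f)                            ≡⟨ cong (2 ·_) (∑-*ˡ xs (f x) f) ⟨
    2 · (∑[ y ← xs ] (f x · f y))                 ≡⟨ ∑-*ˡ xs 2 _ ⟨
    (∑[ y ← xs ] (2 · (f x · f y)))               ≤⟨ ∑-mono xs (λ y → 2xy≤x²+y² (f x) (f y)) ⟩
    (∑[ y ← xs ] (f x · f x + f y · f y))         ≡⟨ ∑-+ xs _ _ ⟩
    (∑[ _ ← xs ] (f x · f x)) + (∑[ y ← xs ] (f y · f y)) ≡⟨ cong (_+ _) (∑-const xs (f x · f x)) ⟩
    length xs · (f x · f x) + (∑[ y ← xs ] (f y · f y)) ∎
  lemma : ∀ a s l t → (a + s) · (a + s) + (l · t + (l · (a · a) + t)) + 0 ≡ suc l · (a · a + t) + (s · s + 2 · (a · s))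
  lemma = solve-∀

-- Stars

-- E ≥ (1 − 1/M) n², where E is the degree sum.
Dense : (M n E : ℕ) → Set
Dense M n E = M · (n · n) ≤ n · n + M · E


-- In terms of the deficit n² - E, density says M·(n² - E) ≤ n², which is monotone in `M` because
-- the deficit is nonnegative.
Dense-weaken : ∀ {M M′ n E} → M ≤ M′ → E ≤ n · n → Dense M′ n E → Dense M n E
Dense-weaken {M} {M′} {n} {E} M≤M′ E≤ dense =
  ≤-cancel (ℕₚ.+-mono-≤ (subst (λ k → Dense k n E) (≡sym (ℕₚ.m+[n∸m]≡n M≤M′)) dense) (ℕₚ.*-monoʳ-≤ (M′ ∸ M) E≤))
           (lemma M (M′ ∸ M) (n · n) E)
  where
  lemma : ∀ M t K E → M · K + (K + (M + t) · E + t · K) + 0 ≡ K + M · E + ((M + t) · K + t · E)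
  lemma = solve-∀

-- 16 r³ (r+1), the value of M needed below for stars with r leaves.
threshold : ℕ → ℕ
threshold r = 2 · (2 · (4 · (r · r)) · suc r) · r

threshold-mono : ∀ {r s} → r ≤ s → threshold r ≤ threshold s
threshold-mono r≤s = ℕₚ.*-mono-≤ (ℕₚ.*-monoʳ-≤ 2 (ℕₚ.*-mono-≤
  (ℕₚ.*-monoʳ-≤ 2 (ℕₚ.*-monoʳ-≤ 4 (ℕₚ.*-mono-≤ r≤s r≤s))) (s≤s r≤s))) r≤s

-- Vertices of degree < (1 − 1/T) n are deleted.  If there are none, T = 4r² keeps the second-order terms below
-- the first-order gain r − 1.  Deleting one of degree d loses at most d n^(r−1) (R − 1/P) of Σ d(v)^r against a
-- gain of about R d n^(r−1) on the other side; M makes the lower-order errors smaller than 1/P.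
module Star (q : ℕ) where
  r R T P M : ℕ
  r = 2 + q
  R = suc r
  T = 4 · (r · r)
  P = 2 · T
  M = threshold r

  -- Chosen so that 2r = m + 2, which gives the exponents the successor form of `^-lower` and
  -- `^-upper`.
  m : ℕ
  m = 2 + 2 · q

  r+r : r + r ≡ suc (suc m)
  r+r = lemma q
    where
    lemma : ∀ q → 2 + q + (2 + q) ≡ suc (suc (2 + 2 · q))
    lemma = solve-∀

  square-^r : ∀ x → x ^ r · x ^ r ≡ x ^ suc (suc m)
  square-^r x = trans (≡sym (ℕₚ.^-distribˡ-+-* x r r)) (cong (x ^_) r+r)

  -- The slope of t^(2r) at t = n is 2r·n^(2r-1). The degree condition says n - d ≤ n/T, and on so
  -- short an interval the slope stays above (r + 1)·n^(2r-1).
  high-degree-power : ∀ n d → d ≤ n → T · n ≤ n + T · d →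
    d ^ suc (suc m) + R · (n ∸ d) · n ^ suc m ≤ n ^ suc (suc m)
  high-degree-power n d d≤n high = subst
    (λ k → d ^ suc (suc m) + R · x · k ^ suc m ≤ k ^ suc (suc m)) d+x≡n
    (ℕₚ.≤-trans (ℕₚ.+-monoʳ-≤ (d ^ suc (suc m)) slope) (^-lower (suc m) d x))
    where
    x = n ∸ d
    d+x≡n : d + x ≡ n
    d+x≡n = ℕₚ.m+[n∸m]≡n d≤n
    Tx≤ : T · x ≤ d + x
    Tx≤ = ≤-cancel (subst (λ k → T · k ≤ k + T · d) (≡sym d+x≡n) high) (lemma T d x)
      where
      lemma : ∀ T d x → T · x + (d + x + T · d) + 0 ≡ d + x + T · (d + x)
      lemma = solve-∀
    N₁ = (d + x) ^ suc m
    D₁ = d ^ suc m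
    upper : T · N₁ ≤ T · D₁ + suc m · N₁
    upper = ≤-cancel (ℕₚ.+-mono-≤ (ℕₚ.*-monoʳ-≤ T (^-upper m d x))
                                   (ℕₚ.*-monoʳ-≤ (suc m · (d + x) ^ m) Tx≤))
                     (lemma T (d + x) x D₁ m ((d + x) ^ m))
      where
      lemma : ∀ T n x D m a → T · (n · a) + (T · (D + suc m · x · a) + suc m · a · n) + 0
        ≡ T · D + suc m · (n · a) + (T · (n · a) + suc m · a · (T · x))
      lemma = solve-∀
    -- Here T = 4r² enters: 2r·(1 - (2r - 1)/T) ≥ r + 1 for r ≥ 2.
    ratio : R · N₁ ≤ suc (suc m) · D₁
    ratio = ℕₚ.*-cancelˡ-≤ (2 · r) (≤-cancel upper (lemma q D₁ N₁))
      where
      lemma : ∀ q D N → let r = 2 + q ; T = 4 · (r · r) ; m = 2 + 2 · q in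
        2 · r · (suc r · N) + (T · D + suc m · N) + (2 · (q · q) + 4 · q + 1) · N ≡ 2 · r · (suc (suc m) · D) + T · N
      lemma = solve-∀
    slope : R · x · N₁ ≤ suc (suc m) · x · D₁
    slope = ≤-cancel (ℕₚ.*-monoʳ-≤ x ratio) (lemma R (suc (suc m)) x N₁ D₁)
      where
      lemma : ∀ a b x N D → a · x · N + x · (b · D) + 0 ≡ b · x · D + x · (a · N)
      lemma = solve-∀

  -- `S` and `E` belong to the graph left after deleting a vertex of degree `d`, `n` is its number
  -- of vertices and `D` the drop in the star sum. Since (S + D)² ≤ S² + 2D(S + D) and (E + 2d)^R ≥
  -- E^R + 2dR·E^r, it suffices that D(S + D) ≤ R·d·E^r.
  low-degree-step : ∀ n d E S D → P · d + n ≤ P · n → P · D + d · n ^ suc q ≤ P · R · (d · n ^ suc q) →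
    S · S ≤ E ^ R → S + D ≤ suc n · n ^ r → M ≤ suc n → E ≤ n · n → Dense M n E →
    (S + D) · (S + D) ≤ (E + 2 · d) ^ R
  low-degree-step n d E S D low bound IH trivial M≤ E≤ dense =
    ℕₚ.≤-trans (≤-cancel (ℕₚ.+-mono-≤ IH (ℕₚ.*-monoʳ-≤ 2 gain)) (lemma S D R d (E ^ r) (E ^ R)))
               (^-lower r E (2 · d))
    where
    lemma : ∀ S D R d a b → (S + D) · (S + D) + (b + 2 · (R · d · a)) + D · D ≡ b + R · (2 · d) · a + (S · S + 2 · (D · (S + D)))
    lemma = solve-∀
    K = n · n
    z = K ∸ E
    E+z : E + z ≡ K
    E+z = ℕₚ.m+[n∸m]≡n E≤
    Mz≤ : M · z ≤ K
    Mz≤ = ≤-cancel dense (trans (lem M z K E) (cong (λ k → K + M · k) E+z))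
      where
      lem : ∀ M z K E → M · z + (K + M · E) + 0 ≡ K + M · (E + z)
      lem = solve-∀
    -- `M` is r times this number, so a deficit of at most K/M in `E` costs at most K^r/(2PR) in the
    -- r-th power.
    pr = 2 · (P · R)
    density : pr · K ^ r ≤ pr · E ^ r + K ^ r
    density = subst (λ k → pr · k ^ r ≤ pr · E ^ r + k ^ r) E+z
      (≤-cancel (ℕₚ.+-mono-≤ (ℕₚ.*-monoʳ-≤ pr (^-upper (suc q) E z))
                             (ℕₚ.*-monoˡ-≤ ((E + z) ^ suc q) (subst (M · z ≤_) (≡sym E+z) Mz≤)))
                (lem pr r (E + z) z ((E + z) ^ suc q) (E ^ r)))
      where
      lem : ∀ p r k z a b → p · (k · a) + (p · (b + r · z · a) + k · a) + 0 ≡ p · b + k · a + (p · (k · a) + p · r · z · a)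
      lem = solve-∀
    pr≤n : pr ≤ n
    pr≤n = ℕₚ.+-cancelˡ-≤ 1 pr n (ℕₚ.≤-trans (pr<M) M≤)
      where
      pr<M : suc pr ≤ M
      pr<M = ℕₚ.≤-trans (ℕₚ.+-monoˡ-≤ pr {1} {pr} (s≤s z≤n))
        (≤-cancel (z≤n {0}) (lem pr q))
        where
        lem : ∀ p q → p + p + 0 + p · q ≡ p · (2 + q) + 0
        lem = solve-∀
    K^r : n ^ r · n ^ r ≡ K ^ r
    K^r = ≡sym (^-distrib-· r n n)
    X = n ^ suc q
    -- w/P = R - 1/P is the improved coefficient supplied by `bound`.
    w = ℕ.pred (P · R)
    suc-w : suc w ≡ P · R
    suc-w = ℕₚ.suc-pred (P · R)
    PD≤ : P · D ≤ w · (d · X)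
    PD≤ = ≤-cancel (subst (λ k → P · D + d · X ≤ k · (d · X)) (≡sym suc-w) bound) (lem (P · D) w (d · X))
      where
      lem : ∀ a w x → a + suc w · x + 0 ≡ w · x + (a + x)
      lem = solve-∀
    2w≤n : 2 · w ≤ n
    2w≤n = ℕₚ.≤-trans (ℕₚ.*-monoʳ-≤ 2 (ℕₚ.≤-trans (ℕₚ.n≤1+n w) (ℕₚ.≤-reflexive suc-w))) pr≤n
    -- The factor n + 1 in `trivial` leaves a surplus 2w besides 2w·n. As 2w ≤ n it costs one unit,
    -- and 2w + 1 = 2PR - 1 is just what `density′` can absorb.
    leading : 2 · (P · (D · (S + D))) ≤ d · ((2 · w + 1) · K ^ r)
    leading = begin
      2 · (P · (D · (S + D)))                     ≡⟨ lem₁ P D (S + D) ⟩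
      2 · (P · D · (S + D))                       ≤⟨ ℕₚ.*-monoʳ-≤ 2 (ℕₚ.*-mono-≤ PD≤ trivial) ⟩
      2 · (w · (d · X) · (suc n · (n · X)))       ≡⟨ lem₂ w d X n ⟩
      d · X · (n · X) · (2 · w + 2 · w · n)       ≤⟨ ℕₚ.*-monoʳ-≤ (d · X · (n · X)) (ℕₚ.+-monoˡ-≤ (2 · w · n) 2w≤n) ⟩
      d · X · (n · X) · (n + 2 · w · n)           ≡⟨ lem₃ w d X n ⟩
      d · ((2 · w + 1) · (n · X · (n · X)))       ≡⟨ cong (λ k → d · ((2 · w + 1) · k)) K^r ⟩
      d · ((2 · w + 1) · K ^ r)                   ∎
      where
      open ℕₚ.≤-Reasoning
      lem₁ : ∀ P D s → 2 · (P · (D · s)) ≡ 2 · (P · D · s)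
      lem₁ = solve-∀
      lem₂ : ∀ w d X n → 2 · (w · (d · X) · (suc n · (n · X))) ≡ d · X · (n · X) · (2 · w + 2 · w · n)
      lem₂ = solve-∀
      lem₃ : ∀ w d X n → d · X · (n · X) · (n + 2 · w · n) ≡ d · ((2 · w + 1) · (n · X · (n · X)))
      lem₃ = solve-∀
    density′ : (2 · w + 1) · K ^ r ≤ 2 · (P · R) · E ^ r
    density′ = ≤-cancel density (trans (lem w (K ^ r) pr (E ^ r)) (cong (λ p → pr · E ^ r + 2 · p · K ^ r) suc-w))
      where
      lem : ∀ w k p e → (2 · w + 1) · k + (p · e + k) + 0 ≡ p · e + 2 · suc w · k
      lem = solve-∀
    gain : D · (S + D) ≤ R · d · E ^ r
    gain = ℕₚ.*-cancelˡ-≤ P (ℕₚ.*-cancelˡ-≤ 2 (begin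
      2 · (P · (D · (S + D)))       ≤⟨ leading ⟩
      d · ((2 · w + 1) · K ^ r)     ≤⟨ ℕₚ.*-monoʳ-≤ d density′ ⟩
      d · (2 · (P · R) · E ^ r)     ≡⟨ lem d P R (E ^ r) ⟩
      2 · (P · (R · d · E ^ r))     ∎))
      where
      open ℕₚ.≤-Reasoning
      lem : ∀ d P R e → d · (2 · (P · R) · e) ≡ 2 · (P · (R · d · e))
      lem = solve-∀

-- Degree sums and star sums under vertex deletion

module StarSums {A : Set} (adjacent : A → A → Bool)
  (adjacent-sym : ∀ x y → adjacent x y ≡ adjacent y x) (adjacent-irrefl : ∀ x → adjacent x x ≡ false) where

  deg : A → List A → ℕ
  deg x vs = ∑[ y ← vs ] 𝟙 (adjacent x y)

  degreeSum : List A → ℕ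
  degreeSum vs = ∑[ x ← vs ] deg x vs

  starSum : ℕ → List A → ℕ
  starSum r vs = ∑[ x ← vs ] deg x vs ^ r

  deg≤length : ∀ x vs → deg x vs ≤ length vs
  deg≤length x []       = z≤n
  deg≤length x (y ∷ vs) = ℕₚ.+-mono-≤ (𝟙≤1 (adjacent x y)) (deg≤length x vs)

  deg<length : ∀ {x vs} → x ∈ vs → deg x vs < length vs
  deg<length {x} {y ∷ vs} (here refl) rewrite adjacent-irrefl x = s≤s (deg≤length x vs)
  deg<length {x} {y ∷ vs} (there x∈)  =
    subst (_≤ suc (length vs)) (ℕₚ.+-suc _ _) (ℕₚ.+-mono-≤ (𝟙≤1 (adjacent x y)) (deg<length x∈))

  degreeSum≤ : ∀ vs → degreeSum vs ≤ length vs · length vs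
  degreeSum≤ vs = subst (degreeSum vs ≤_) (∑-const vs _) (∑-mono vs (λ x → deg≤length x vs))

  degreeSum-↭ : ∀ {vs ws} → vs ↭ ws → degreeSum vs ≡ degreeSum ws
  degreeSum-↭ {vs} {ws} p = trans (∑-↭ p _) (∑-cong ws (λ x → ∑-↭ p _))

  starSum-↭ : ∀ r {vs ws} → vs ↭ ws → starSum r vs ≡ starSum r ws
  starSum-↭ r {vs} {ws} p = trans (∑-↭ p _) (∑-cong ws (λ x → cong (_^ r) (∑-↭ p _)))

  deg-∷ : ∀ v ws → deg v (v ∷ ws) ≡ deg v ws
  deg-∷ v ws = cong (λ b → 𝟙 b + deg v ws) (adjacent-irrefl v)

  degreeSum-∷ : ∀ v ws → degreeSum (v ∷ ws) ≡ degreeSum ws + 2 · deg v ws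
  degreeSum-∷ v ws = begin
    deg v (v ∷ ws) + (∑[ u ← ws ] (𝟙 (adjacent u v) + deg u ws))
      ≡⟨ cong₂ _+_ (deg-∷ v ws) (∑-+ ws _ _) ⟩
    deg v ws + ((∑[ u ← ws ] 𝟙 (adjacent u v)) + degreeSum ws)
      ≡⟨ cong (λ s → deg v ws + (s + degreeSum ws)) (∑-cong ws (λ u → cong 𝟙 (adjacent-sym u v))) ⟩
    deg v ws + (deg v ws + degreeSum ws)
      ≡⟨ lemma (deg v ws) (degreeSum ws) ⟩
    degreeSum ws + 2 · deg v ws ∎
    where
    open ≡-Reasoning
    lemma : ∀ d e → d + (d + e) ≡ e + 2 · d
    lemma = solve-∀

  module _ (q : ℕ) where
    open Star q

    -- Adding `v` creates the term d^r and raises the degree of each of its d neighbours by one. The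
    -- new degree is at most l, the length of `ws`, so each such power grows by at most r·l^(r-1).
    starSum-∷ : ∀ v ws → starSum r (v ∷ ws) ≤ starSum r ws + (deg v ws ^ r + r · (deg v ws · length ws ^ suc q))
    starSum-∷ v ws = begin
      deg v (v ∷ ws) ^ r + (∑[ u ← ws ] ((𝟙 (adjacent u v) + deg u ws) ^ r))
        ≤⟨ ℕₚ.+-mono-≤ (ℕₚ.≤-reflexive (cong (_^ r) (deg-∷ v ws))) (∑-mono-∈ ws step) ⟩
      deg v ws ^ r + (∑[ u ← ws ] (deg u ws ^ r + 𝟙 (adjacent v u) · (r · length ws ^ suc q)))
        ≡⟨ cong (deg v ws ^ r +_) (trans (∑-+ ws _ _) (cong (starSum r ws +_) (∑-*ʳ ws _ _))) ⟩
      deg v ws ^ r + (starSum r ws + deg v ws · (r · length ws ^ suc q))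
        ≡⟨ lemma (deg v ws ^ r) (starSum r ws) (deg v ws) r (length ws ^ suc q) ⟩
      starSum r ws + (deg v ws ^ r + r · (deg v ws · length ws ^ suc q)) ∎
      where
      open ℕₚ.≤-Reasoning
      lemma : ∀ p s d r x → p + (s + d · (r · x)) ≡ s + (p + r · (d · x))
      lemma = solve-∀
      step : ∀ {u} → u ∈ ws → (𝟙 (adjacent u v) + deg u ws) ^ r ≤ deg u ws ^ r + 𝟙 (adjacent v u) · (r · length ws ^ suc q)
      step {u} u∈ rewrite adjacent-sym u v with adjacent v u
      ... | false = ℕₚ.m≤m+n _ _
      ... | true  = begin
        (1 + deg u ws) ^ r                                       ≡⟨ cong (_^ r) (ℕₚ.+-comm 1 (deg u ws)) ⟩
        (deg u ws + 1) ^ r                                       ≤⟨ ^-upper (suc q) (deg u ws) 1 ⟩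
        deg u ws ^ r + r · 1 · (deg u ws + 1) ^ suc q
          ≤⟨ ℕₚ.+-monoʳ-≤ (deg u ws ^ r) (ℕₚ.*-monoʳ-≤ (r · 1)
               (ℕₚ.^-monoˡ-≤ (suc q) (subst (_≤ length ws) (ℕₚ.+-comm 1 (deg u ws)) (deg<length u∈)))) ⟩
        deg u ws ^ r + r · 1 · length ws ^ suc q                 ≡⟨ cong (deg u ws ^ r +_) (lem r (length ws ^ suc q)) ⟩
        deg u ws ^ r + 1 · (r · length ws ^ suc q)               ∎
        where
        lem : ∀ r x → r · 1 · x ≡ 1 · (r · x)
        lem = solve-∀

    starSum-mono-∷ : ∀ v ws → starSum r ws ≤ starSum r (v ∷ ws)
    starSum-mono-∷ v ws = ℕₚ.≤-trans (∑-mono ws (λ u → ℕₚ.^-monoˡ-≤ r (ℕₚ.m≤n+m (deg u ws) (𝟙 (adjacent u v))))) (ℕₚ.m≤n+m _ _)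

    starSum≤ : ∀ v ws → starSum r (v ∷ ws) ≤ suc (length ws) · length ws ^ r
    starSum≤ v ws = subst (starSum r (v ∷ ws) ≤_) (∑-const (v ∷ ws) _)
      (∑-mono-∈ (v ∷ ws) (λ u∈ → ℕₚ.^-monoˡ-≤ r (ℕₚ.≤-pred (deg<length u∈))))

    -- Without loops every vertex contributes at least one to the deficit n² - E. Density allows a
    -- deficit of at most n²/M, hence n ≤ n²/M.
    dense⇒large : ∀ v ws → Dense M (suc (length ws)) (degreeSum (v ∷ ws)) → M ≤ suc (length ws)
    dense⇒large v ws dense = ℕₚ.*-cancelʳ-≤ M n n
      (≤-cancel (ℕₚ.≤-trans dense (ℕₚ.+-monoʳ-≤ (n · n) (ℕₚ.*-monoʳ-≤ M edges≤))) (lemma M (length ws)))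
      where
      n = suc (length ws)
      edges≤ : degreeSum (v ∷ ws) ≤ n · length ws
      edges≤ = subst (degreeSum (v ∷ ws) ≤_) (∑-const (v ∷ ws) _) (∑-mono-∈ (v ∷ ws) (ℕₚ.≤-pred ∘ deg<length))
      lemma : ∀ M l → M · suc l + (suc l · suc l + M · (suc l · l)) + 0 ≡ suc l · suc l + M · (suc l · suc l)
      lemma = solve-∀

    -- With z the deficit n² - E, Cauchy-Schwarz and `high-degree-power` bound the left side by
    -- n^(2r+2) - R·z·n^(2r). This is the tangent of t^(r+1) at t = n², evaluated at E, hence at
    -- most E^(r+1). The slope r + 1 in `high-degree-power` is dictated by this match.
    starSum-bound-high : ∀ vs → All (λ v → T · length vs ≤ length vs + T · deg v vs) vs →
      starSum r vs · starSum r vs ≤ degreeSum vs ^ R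
    starSum-bound-high vs high = begin
      starSum r vs · starSum r vs                        ≤⟨ ∑-cauchy-schwarz vs _ ⟩
      n · (∑[ x ← vs ] (deg x vs ^ r · deg x vs ^ r))    ≡⟨ cong (n ·_) (∑-cong vs (λ x → square-^r (deg x vs))) ⟩
      n · Q                                              ≤⟨ ≤-cancel (ℕₚ.+-mono-≤ (ℕₚ.*-monoʳ-≤ n powers) binomial) (lemma n Q R z (n ^ suc m) (E ^ R)) ⟩
      E ^ R                                              ∎
      where
      open ℕₚ.≤-Reasoning
      n = length vs
      E = degreeSum vs
      Q = ∑[ x ← vs ] deg x vs ^ suc (suc m)
      z = ∑[ x ← vs ] (n ∸ deg x vs)
      E+z : E + z ≡ n · n
      E+z = trans (≡sym (∑-+ vs _ _)) (trans (∑-cong vs (λ x → ℕₚ.m+[n∸m]≡n (deg≤length x vs))) (∑-const vs n))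
      powers : Q + R · z · n ^ suc m ≤ n · n ^ suc (suc m)
      powers = begin
        Q + R · z · n ^ suc m
          ≡⟨ cong (Q +_) (trans (cong (_· n ^ suc m) (≡sym (∑-*ˡ vs R _))) (≡sym (∑-*ʳ vs _ _))) ⟩
        Q + (∑[ x ← vs ] (R · (n ∸ deg x vs) · n ^ suc m))
          ≡⟨ ∑-+ vs _ _ ⟨
        (∑[ x ← vs ] (deg x vs ^ suc (suc m) + R · (n ∸ deg x vs) · n ^ suc m))
          ≤⟨ ∑-mono-∈ vs (λ {x} x∈ → high-degree-power n (deg x vs) (deg≤length x vs) (lookup high x∈)) ⟩
        (∑[ _ ← vs ] n ^ suc (suc m))
          ≡⟨ ∑-const vs _ ⟩
        n · n ^ suc (suc m) ∎
      n²^r : (n · n) ^ r ≡ n ^ suc (suc m)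
      n²^r = trans (^-distrib-· r n n) (square-^r n)
      binomial : n · n · n ^ suc (suc m) ≤ E ^ R + R · z · n ^ suc (suc m)
      binomial = subst₂ (λ k p → k · p ≤ E ^ R + R · z · p) E+z (trans (cong (_^ r) E+z) n²^r) (^-upper r E z)
      lemma : ∀ n Q R z a e → n · Q + (n · (n · (n · a)) + (e + R · z · (n · a))) + 0
        ≡ e + (n · (Q + R · z · a) + n · n · (n · a))
      lemma = solve-∀

    -- Induction over the deletions; `n` carries the length because the remaining list `ys ++ zs` is
    -- not structurally smaller.
    starSum-bound-≥2 : ∀ n vs → length vs ≡ n → Dense M (length vs) (degreeSum vs) →
      starSum r vs · starSum r vs ≤ degreeSum vs ^ R
    starSum-bound-≥2 zero    [] _ _ = z≤n
    starSum-bound-≥2 (suc n) vs eq dense with all? (λ v → T · length vs ≤? length vs + T · deg v vs) vs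
    ... | yes high = starSum-bound-high vs high
    ... | no ¬high with find (¬All⇒Any¬ (λ v → T · length vs ≤? length vs + T · deg v vs) vs ¬high)
    ... | v , v∈ , ¬high-v with ∈-∃++ v∈
    ... | ys , zs , refl = goal
      where
      ws = ys ++ zs
      vs↭ : vs ↭ v ∷ ws
      vs↭ = shift v ys zs
      l = length ws
      d = deg v ws
      length-vs : length vs ≡ suc l
      length-vs = ↭-length vs↭
      dense′ : Dense M (suc l) (degreeSum (v ∷ ws))
      dense′ = subst₂ (Dense M) length-vs (degreeSum-↭ vs↭) dense
      M≤ : M ≤ suc l
      M≤ = dense⇒large v ws dense′
      low : suc l + T · d < T · suc l
      low = subst₂ (λ k e → k + T · e < T · k) length-vs (trans (∑-↭ vs↭ _) (deg-∷ v ws)) (ℕₚ.≰⇒> ¬high-v)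
      P≤M : P ≤ M
      P≤M = ≤-cancel (z≤n {0}) (lemma P q)
        where
        lemma : ∀ P q → P + 0 + P · (4 · q + 2 · q · q + 11 + 6 · q) ≡ 2 · (P · (3 + q)) · (2 + q) + 0
        lemma = solve-∀
      -- From d < (1 - 1/T)(l + 1) to d ≤ (1 - 1/P)·l: with P = 2T half of the gap is given up to
      -- pay for replacing l + 1 by l, using P ≤ l + 1.
      low′ : P · d + l ≤ P · l
      low′ = ≤-cancel (ℕₚ.+-mono-≤ (ℕₚ.*-monoʳ-≤ 2 low) (ℕₚ.≤-trans P≤M M≤)) (lemma T d l)
        where
        lemma : ∀ T d l → 2 · T · d + l + (2 · (T · suc l) + suc l) + 3 ≡ 2 · T · l + (2 · (suc (suc l + T · d)) + 2 · T)
        lemma = solve-∀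
      -- The deleted vertex takes away a deficit of at least 2l/P + 1, while the allowance n²/M
      -- shrinks only by (2l + 1)/M.
      dense″ : Dense M l (degreeSum ws)
      dense″ = ≤-cancel (ℕₚ.+-mono-≤ (subst (Dense M (suc l)) (degreeSum-∷ v ws) dense′) (ℕₚ.+-mono-≤ (ℕₚ.*-monoʳ-≤ (2 · (2 · R · r)) low′) 1≤M))
                 (lemma P q l d (degreeSum ws))
        where
        1≤M : 1 ≤ M
        1≤M = ℕₚ.≤-trans (s≤s z≤n) P≤M
        lemma : ∀ P q l d e → let r = 2 + q ; R = suc r ; M = 2 · (P · R) · r in
          M · (l · l) + (suc l · suc l + M · (e + 2 · d) + (2 · (2 · R · r) · (P · l) + M)) + (4 · q · q + 20 · q + 22) · l
          ≡ l · l + M · e + (M · (suc l · suc l) + (2 · (2 · R · r) · (P · d + l) + 1))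
        lemma = solve-∀
      X = l ^ suc q
      D = starSum r (v ∷ ws) ∸ starSum r ws
      S+D : starSum r ws + D ≡ starSum r (v ∷ ws)
      S+D = ℕₚ.m+[n∸m]≡n (starSum-mono-∷ v ws)
      D≤ : D ≤ d ^ r + r · (d · X)
      D≤ = ℕₚ.m≤n+o⇒m∸n≤o _ (starSum r ws) (starSum-∷ v ws)
      -- Of the r factors of d^r one stays, one is bounded by (1 - 1/P)·l and the rest by l. This is
      -- the source of the gain 1/P in `bound`.
      power : P · d ^ r + d · X ≤ P · (d · X)
      power = ≤-cancel (ℕₚ.+-mono-≤ (ℕₚ.*-monoʳ-≤ (d · l ^ q) low′)
                          (ℕₚ.*-monoʳ-≤ (P · (d · d)) (ℕₚ.^-monoˡ-≤ q (ℕₚ.*-cancelˡ-≤ P (ℕₚ.m+n≤o⇒m≤o _ low′)))))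
                (lemma P d l (l ^ q) (d ^ q))
        where
        lemma : ∀ P d l a b → P · (d · (d · b)) + d · (l · a) + (d · a · (P · l) + P · (d · d) · a) + 0
          ≡ P · (d · (l · a)) + (d · a · (P · d + l) + P · (d · d) · b)
        lemma = solve-∀
      bound : P · D + d · X ≤ P · R · (d · X)
      bound = ≤-cancel (ℕₚ.+-mono-≤ (ℕₚ.*-monoʳ-≤ P D≤) power) (lemma P D (d · X) r (d ^ r))
        where
        lemma : ∀ P D x r a → P · D + x + (P · (a + r · x) + P · x) + 0 ≡ P · suc r · x + (P · D + (P · a + x))
        lemma = solve-∀
      IH : starSum r ws · starSum r ws ≤ degreeSum ws ^ R
      IH = starSum-bound-≥2 n ws (ℕₚ.suc-injective (trans (≡sym length-vs) eq)) dense″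
      goal : starSum r vs · starSum r vs ≤ degreeSum vs ^ R
      goal = subst₂ (λ s e → s · s ≤ e ^ R) (trans S+D (≡sym (starSum-↭ r vs↭)))
        (trans (≡sym (degreeSum-∷ v ws)) (≡sym (degreeSum-↭ vs↭)))
        (low-degree-step l d (degreeSum ws) (starSum r ws) D low′ bound IH
          (subst (_≤ suc l · l ^ r) (≡sym S+D) (starSum≤ v ws)) M≤ (degreeSum≤ ws) dense″)

  -- For a single leaf the star sum is the degree sum and both sides coincide. The deletion argument
  -- takes over from r = 2 on, where 2r exceeds r + 1.
  starSum-bound : ∀ r {M} vs → threshold (suc r) ≤ M → Dense M (length vs) (degreeSum vs) →
    starSum (suc r) vs · starSum (suc r) vs ≤ degreeSum vs ^ suc (suc r)
  starSum-bound zero    vs _  _     = ℕₚ.≤-reflexive (trans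
    (cong (λ s → s · s) (∑-cong vs (λ x → ℕₚ.*-identityʳ (deg x vs))))
    (cong (degreeSum vs ·_) (≡sym (ℕₚ.*-identityʳ (degreeSum vs)))))
  starSum-bound (suc q) vs M≤ dense =
    starSum-bound-≥2 q (length vs) vs refl (Dense-weaken {n = length vs} M≤ (degreeSum≤ vs) dense)

  starSum≤^ : ∀ r {M} vs B → threshold (suc r) ≤ M → Dense M (length vs) (degreeSum vs) →
    degreeSum vs ≤ B · B → starSum (suc r) vs ≤ B ^ suc (suc r)
  starSum≤^ r vs B M≤ dense E≤ = ²-cancel-≤ (begin
    starSum (suc r) vs · starSum (suc r) vs ≤⟨ starSum-bound r vs M≤ dense ⟩
    degreeSum vs ^ suc (suc r)              ≤⟨ ℕₚ.^-monoˡ-≤ (suc (suc r)) E≤ ⟩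
    (B · B) ^ suc (suc r)                   ≡⟨ ^-distrib-· (suc (suc r)) B B ⟩
    B ^ suc (suc r) · B ^ suc (suc r)       ∎)
    where open ℕₚ.≤-Reasoning

-- Enumerations up to a Boolean equality

Enumerates : (A → A → Bool) → List A → Set
Enumerates eq xs = ∀ a → ∑[ x ← xs ] 𝟙 (eq x a) ≡ 1

-- Without function extensionality, a function occurs among those built by `enum` only up to
-- agreement of values, so multiplicities are counted with this relation.
pointwise : (A → A → Bool) → ∀ m → (Fin m → A) → (Fin m → A) → Bool
pointwise eq m f g = allV m (λ i → eq (f i) (g i))

allFin-enumerates : ∀ n → Enumerates _=F_ (allFin n)
allFin-enumerates (suc n) zero    =
  trans (∑-allFin-suc n (λ x → 𝟙 (x =F zero))) (cong suc (∑-zero (allFin n) (λ _ → refl)))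
allFin-enumerates (suc n) (suc i) = trans (∑-allFin-suc n (λ x → 𝟙 (x =F suc i))) (allFin-enumerates n i)

bools-enumerates : Enumerates _==ᵇ_ bools
bools-enumerates true  = refl
bools-enumerates false = refl

enum-enumerates : ∀ (eq : A → A → Bool) {xs} → Enumerates eq xs → ∀ m → Enumerates (pointwise eq m) (enum xs m)
enum-enumerates eq xs! zero    g = refl
enum-enumerates eq {xs} xs! (suc m) g = begin
  (∑[ f ← enum xs (suc m) ] 𝟙 (pointwise eq (suc m) f g))
    ≡⟨ ∑-enum-suc xs m _ ⟩
  (∑[ f ← enum xs m ] ∑[ x ← xs ] 𝟙 (pointwise eq (suc m) (x VF.∷ f) g))
    ≡⟨ ∑-cong (enum xs m) (λ f → ∑-cong xs (λ x → trans (cong 𝟙 (allV-suc m _)) (𝟙-∧ (eq x (g zero)) _))) ⟩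
  (∑[ f ← enum xs m ] ∑[ x ← xs ] (𝟙 (eq x (g zero)) · 𝟙 (pointwise eq m f (g ∘ suc))))
    ≡⟨ ∑-cong (enum xs m) (λ f → trans (∑-*ʳ xs _ _) (cong (_· 𝟙 (pointwise eq m f (g ∘ suc))) (xs! (g zero)))) ⟩
  (∑[ f ← enum xs m ] (1 · 𝟙 (pointwise eq m f (g ∘ suc))))
    ≡⟨ ∑-*ˡ (enum xs m) 1 _ ⟩
  1 · (∑[ f ← enum xs m ] 𝟙 (pointwise eq m f (g ∘ suc)))
    ≡⟨ cong (1 ·_) (enum-enumerates eq xs! m (g ∘ suc)) ⟩
  1 ∎
  where open ≡-Reasoning

maps-enumerates : ∀ k n → Enumerates (pointwise _=F_ k) (maps k n)
maps-enumerates k n = enum-enumerates _=F_ (allFin-enumerates n) k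

subsets-enumerates : ∀ n → Enumerates (pointwise _==ᵇ_ n) (subsets n)
subsets-enumerates n = enum-enumerates _==ᵇ_ bools-enumerates n

matrices-enumerates : ∀ n → Enumerates (pointwise (pointwise _==ᵇ_ n) n) (matrices n)
matrices-enumerates n = enum-enumerates (pointwise _==ᵇ_ n) (subsets-enumerates n) n

pointwise-=F : ∀ {k n} (f g : Fin k → Fin n) → pointwise _=F_ k f g ≡ true → ∀ i → f i ≡ g i
pointwise-=F {k} f g h i = =F-elim (allV-elim k h i)

pointwise-==ᵇ : ∀ {n} (f g : Fin n → Bool) → pointwise _==ᵇ_ n f g ≡ true → ∀ i → f i ≡ g i
pointwise-==ᵇ {n} f g h i = ==ᵇ-elim (allV-elim n h i)

pointwise-matrix : ∀ {n} (F G : Adj n) → pointwise (pointwise _==ᵇ_ n) n F G ≡ true → ∀ i j → F i j ≡ G i j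
pointwise-matrix {n} F G h i = pointwise-==ᵇ (F i) (G i) (allV-elim n h i)

-- Copies of H versus injective homomorphisms from H

injectiveᵇ : ∀ {k n} → (Fin k → Fin n) → Bool
injectiveᵇ {k} f = allV k (λ i → allV k (λ j → (f i =F f j) ⇒ᵇ (i =F j)))

injectiveᵇ-elim : ∀ {k n} (f : Fin k → Fin n) → injectiveᵇ f ≡ true → ∀ i j → f i ≡ f j → i ≡ j
injectiveᵇ-elim {k} f h i j eq = =F-elim (⇒ᵇ-elim (allV-elim k (allV-elim k h i) j) (=F-intro eq))

injectiveᵇ-intro : ∀ {k n} (f : Fin k → Fin n) → (∀ i j → f i ≡ f j → i ≡ j) → injectiveᵇ f ≡ true
injectiveᵇ-intro {k} f h = allV-intro k (λ i → allV-intro k (λ j → ⇒ᵇ-intro (λ eq → =F-intro (h i j (=F-elim eq)))))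

module _ {k} (n : ℕ) (H : SimpleGraph k) where

  record IsIso (W : Fin n → Bool) (F : Adj n) (f : Fin k → Fin n) : Set where
    field
      injective : ∀ i j → f i ≡ f j → i ≡ j
      onto      : ∀ v → W v ≡ true → ∃ λ i → f i ≡ v
      into      : ∀ i → W (f i) ≡ true
      preserves : ∀ i j → F (f i) (f j) ≡ adj H i j
  open IsIso

  -- Spelled like the local test inside `isoTo`, so that `isoTo` unfolds to `any` of this predicate.
  isIsoᵇ : (Fin n → Bool) → Adj n → (Fin k → Fin n) → Bool
  isIsoᵇ W F f = injectiveᵇ f
    ∧ allV n (λ v → W v ==ᵇ anyV k (λ i → f i =F v))
    ∧ allV k (λ i → allV k (λ j → F (f i) (f j) ==ᵇ adj H i j))

  isIsoᵇ-elim : ∀ W F f → isIsoᵇ W F f ≡ true → IsIso W F f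
  isIsoᵇ-elim W F f h =
    let inj , h′ = ∧-elim h ; im , pres = ∧-elim h′ in record
    { injective = injectiveᵇ-elim f inj
    ; onto      = λ v Wv → let i , fi = anyV-elim k (trans (≡sym (==ᵇ-elim (allV-elim n im v))) Wv) in i , =F-elim fi
    ; into      = λ i → trans (==ᵇ-elim (allV-elim n im (f i))) (anyV-intro k i (=F-refl (f i)))
    ; preserves = λ i j → ==ᵇ-elim (allV-elim k (allV-elim k pres i) j)
    }

  isIsoᵇ-intro : ∀ W F f → IsIso W F f → isIsoᵇ W F f ≡ true
  isIsoᵇ-intro W F f iso = ∧-intro (injectiveᵇ-intro f (injective iso)) (∧-intro
    (allV-intro n (λ v → ==ᵇ-intro (bool-ext
      (λ Wv → let i , fi = onto iso v Wv in anyV-intro k i (=F-intro fi))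
      (λ im → let i , fi = anyV-elim k im in subst (λ v → W v ≡ true) (=F-elim fi) (into iso i)))))
    (allV-intro k (λ i → allV-intro k (λ j → ==ᵇ-intro (preserves iso i j)))))

  isHomᵇ : Adj n → (Fin k → Fin n) → Bool
  isHomᵇ G f = allV k (λ i → allV k (λ j → adj H i j ⇒ᵇ G (f i) (f j)))

  isEmbeddingᵇ : Adj n → (Fin k → Fin n) → Bool
  isEmbeddingᵇ G f = injectiveᵇ f ∧ isHomᵇ G f

  embeddings : Adj n → ℕ
  embeddings G = ∑[ f ← maps k n ] 𝟙 (isEmbeddingᵇ G f)

  image : (Fin k → Fin n) → Fin n → Bool
  image f v = anyV k (λ i → f i =F v)

  imageEdges : (Fin k → Fin n) → Adj n
  imageEdges f u v = anyV k (λ i → anyV k (λ j → (f i =F u) ∧ (f j =F v) ∧ adj H i j))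

  imageEdges-elim : ∀ f {u v} → imageEdges f u v ≡ true → ∃ λ i → ∃ λ j → (f i ≡ u) × (f j ≡ v) × (adj H i j ≡ true)
  imageEdges-elim f h =
    let i , h₁ = anyV-elim k h ; j , h₂ = anyV-elim k h₁ ; fi , h₃ = ∧-elim h₂ ; fj , e = ∧-elim h₃
    in i , j , =F-elim fi , =F-elim fj , e

  imageEdges-intro : ∀ f i j → adj H i j ≡ true → imageEdges f (f i) (f j) ≡ true
  imageEdges-intro f i j e = anyV-intro k i (anyV-intro k j (∧-intro (=F-refl (f i)) (∧-intro (=F-refl (f j)) e)))

  isSimple-elim : ∀ F → isSimple n F ≡ true → (∀ i j → F i j ≡ F j i) × (∀ i → F i i ≡ false)
  isSimple-elim F h = let s , ir = ∧-elim h in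
    (λ i j → ==ᵇ-elim (allV-elim n (allV-elim n s i) j)) ,
    (λ i → not-true (λ Fii → true≢false (allV-elim n ir i) (cong not Fii)))

  isSimple-intro : ∀ F → (∀ i j → F i j ≡ F j i) → (∀ i → F i i ≡ false) → isSimple n F ≡ true
  isSimple-intro F s ir = ∧-intro
    (allV-intro n (λ i → allV-intro n (λ j → ==ᵇ-intro (s i j))))
    (allV-intro n (λ i → cong not (ir i)))

  -- An isomorphism `f` leaves no choice for its copy: `W` is the image of `f` and `F` the image of
  -- the edges of `H`. Such a pair lies in `G` exactly when `f` preserves edges.
  copy-determined : ∀ G W F f →
    isSubgraph n G W F ∧ isIsoᵇ W F f
    ≡ isEmbeddingᵇ G f ∧ pointwise _==ᵇ_ n W (image f) ∧ pointwise (pointwise _==ᵇ_ n) n F (imageEdges f)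
  copy-determined G W F f = bool-ext to from
    where
    to : _ → _
    to h = ∧-intro
      (∧-intro (injectiveᵇ-intro f (injective iso))
        (allV-intro k (λ i → allV-intro k (λ j → ⇒ᵇ-intro (λ e → proj₁ (edge (trans (preserves iso i j) e)))))))
      (∧-intro
        (allV-intro n (λ v → ==ᵇ-intro (bool-ext
          (λ Wv → let i , fi = onto iso v Wv in anyV-intro k i (=F-intro fi))
          (λ im → let i , fi = anyV-elim k im in subst (λ v → W v ≡ true) (=F-elim fi) (into iso i)))))
        (allV-intro n (λ u → allV-intro n (λ v → ==ᵇ-intro (bool-ext (edge-to u v) (edge-from u v))))))
      where
      iso = isIsoᵇ-elim W F f (proj₂ (∧-elim {isSubgraph n G W F} h))
      edge : ∀ {u v} → F u v ≡ true → (G u v ≡ true) × (W u ≡ true) × (W v ≡ true)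
      edge {u} {v} Fuv =
        let g , w = ∧-elim (⇒ᵇ-elim {F u v} (allV-elim n (allV-elim n (proj₂ (∧-elim {isSimple n F} (proj₁ (∧-elim h)))) u) v) Fuv)
        in g , ∧-elim w
      edge-to : ∀ u v → F u v ≡ true → imageEdges f u v ≡ true
      edge-to u v Fuv with edge Fuv
      ... | _ , Wu , Wv with onto iso u Wu | onto iso v Wv
      ... | i , refl | j , refl = imageEdges-intro f i j (trans (≡sym (preserves iso i j)) Fuv)
      edge-from : ∀ u v → imageEdges f u v ≡ true → F u v ≡ true
      edge-from u v h with imageEdges-elim f h
      ... | i , j , refl , refl , e = trans (preserves iso i j) e
    from : _ → _
    from h = ∧-intro
      (∧-intro (isSimple-intro F F-sym F-irrefl)
        (allV-intro n (λ u → allV-intro n (λ v → ⇒ᵇ-intro (edge u v)))))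
      (isIsoᵇ-intro W F f record
        { injective = inj
        ; onto      = λ v Wv → let i , fi = anyV-elim k (trans (≡sym (W≡ v)) Wv) in i , =F-elim fi
        ; into      = W-image
        ; preserves = λ i j → trans (F≡ (f i) (f j)) (bool-ext (pres i j) (imageEdges-intro f i j))
        })
      where
      emb = ∧-elim (proj₁ (∧-elim h))
      inj = injectiveᵇ-elim f (proj₁ emb)
      hom : ∀ i j → adj H i j ≡ true → G (f i) (f j) ≡ true
      hom i j = ⇒ᵇ-elim (allV-elim k (allV-elim k (proj₂ emb) i) j)
      copy≡ = ∧-elim {pointwise _==ᵇ_ n W (image f)} (proj₂ (∧-elim {isEmbeddingᵇ G f} h))
      W≡ = pointwise-==ᵇ W (image f) (proj₁ copy≡)
      F≡ = pointwise-matrix F (imageEdges f) (proj₂ copy≡)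
      W-image : ∀ i → W (f i) ≡ true
      W-image i = trans (W≡ (f i)) (anyV-intro k i (=F-refl (f i)))
      pres : ∀ i j → imageEdges f (f i) (f j) ≡ true → adj H i j ≡ true
      pres i j h with imageEdges-elim f h
      ... | i′ , j′ , fi , fj , e = subst₂ (λ i j → adj H i j ≡ true) (inj i′ i fi) (inj j′ j fj) e
      flip : ∀ u v → imageEdges f u v ≡ true → imageEdges f v u ≡ true
      flip u v h with imageEdges-elim f h
      ... | i , j , refl , refl , e = imageEdges-intro f j i (trans (SimpleGraph.sym H j i) e)
      F-sym : ∀ u v → F u v ≡ F v u
      F-sym u v = trans (F≡ u v) (trans (bool-ext (flip u v) (flip v u)) (≡sym (F≡ v u)))
      F-irrefl : ∀ u → F u u ≡ false
      F-irrefl u = trans (F≡ u u) (not-true no-loop)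
        where
        no-loop : imageEdges f u u ≢ true
        no-loop h with imageEdges-elim f h
        ... | i , j , fi , fj , e with inj i j (trans fi (≡sym fj))
        ... | refl = true≢false e (irrefl H i)
      edge : ∀ u v → F u v ≡ true → G u v ∧ W u ∧ W v ≡ true
      edge u v Fuv with imageEdges-elim f (trans (≡sym (F≡ u v)) Fuv)
      ... | i , j , refl , refl , e = ∧-intro (hom i j e) (∧-intro (W-image i) (W-image j))

  copies-of-embedding : ∀ G f →
    ∑[ W ← subsets n ] ∑[ F ← matrices n ] 𝟙 (isSubgraph n G W F ∧ isIsoᵇ W F f) ≡ 𝟙 (isEmbeddingᵇ G f)
  copies-of-embedding G f = begin
    (∑[ W ← subsets n ] ∑[ F ← matrices n ] 𝟙 (isSubgraph n G W F ∧ isIsoᵇ W F f))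
      ≡⟨ ∑-cong (subsets n) (λ W → ∑-cong (matrices n) (λ F → split W F)) ⟩
    (∑[ W ← subsets n ] ∑[ F ← matrices n ] (e · 𝟙 (eqW W) · 𝟙 (eqF F)))
      ≡⟨ ∑-cong (subsets n) (λ W → trans (∑-*ˡ (matrices n) (e · 𝟙 (eqW W)) _)
           (trans (cong (e · 𝟙 (eqW W) ·_) (matrices-enumerates n (imageEdges f))) (ℕₚ.*-identityʳ _))) ⟩
    (∑[ W ← subsets n ] (e · 𝟙 (eqW W)))
      ≡⟨ ∑-*ˡ (subsets n) e _ ⟩
    e · (∑[ W ← subsets n ] 𝟙 (eqW W))
      ≡⟨ trans (cong (e ·_) (subsets-enumerates n (image f))) (ℕₚ.*-identityʳ e) ⟩
    e ∎
    where
    open ≡-Reasoning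
    e = 𝟙 (isEmbeddingᵇ G f)
    eqW = λ W → pointwise _==ᵇ_ n W (image f)
    eqF = λ F → pointwise (pointwise _==ᵇ_ n) n F (imageEdges f)
    split : ∀ W F → 𝟙 (isSubgraph n G W F ∧ isIsoᵇ W F f) ≡ e · 𝟙 (eqW W) · 𝟙 (eqF F)
    split W F = trans (cong 𝟙 (copy-determined G W F f)) (trans (𝟙-∧ (isEmbeddingᵇ G f) _)
      (trans (cong (e ·_) (𝟙-∧ (eqW W) _)) (≡sym (ℕₚ.*-assoc e _ _))))

open IsIso

automorphisms : ∀ {k} → SimpleGraph k → ℕ
automorphisms {k} H = ∑[ σ ← maps k k ] 𝟙 (isIsoᵇ k H (λ _ → true) (adj H) σ)

module _ {k} (n : ℕ) (H : SimpleGraph k) where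

  private
    isAut = isIsoᵇ k H (λ _ → true) (adj H)

  -- Any two isomorphisms onto the same copy differ by a unique automorphism.
  isos-torsor : ∀ {W F f₀} → IsIso n H W F f₀ → ∀ f →
    𝟙 (isIsoᵇ n H W F f) ≡ ∑[ σ ← maps k k ] 𝟙 (isAut σ ∧ pointwise _=F_ k f (f₀ ∘ σ))
  isos-torsor {W} {F} {f₀} iso₀ f with isIsoᵇ n H W F f in eq
  ... | true  = ≡sym (trans (∑-cong (maps k k) (λ σ → cong 𝟙 (bool-ext (to σ) (from σ)))) (maps-enumerates k k σ₀))
    where
    iso = isIsoᵇ-elim n H W F f eq
    lift : ∀ i → ∃ λ j → f₀ j ≡ f i
    lift i = onto iso₀ (f i) (into iso i)
    σ₀ : Fin k → Fin k
    σ₀ i = proj₁ (lift i)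
    f₀σ₀ : ∀ i → f₀ (σ₀ i) ≡ f i
    f₀σ₀ i = proj₂ (lift i)
    to : ∀ σ → isAut σ ∧ pointwise _=F_ k f (f₀ ∘ σ) ≡ true → pointwise _=F_ k σ σ₀ ≡ true
    to σ h = allV-intro k (λ i → =F-intro (injective iso₀ (σ i) (σ₀ i)
      (trans (≡sym (pointwise-=F f (f₀ ∘ σ) (proj₂ (∧-elim h)) i)) (≡sym (f₀σ₀ i)))))
    from : ∀ σ → pointwise _=F_ k σ σ₀ ≡ true → isAut σ ∧ pointwise _=F_ k f (f₀ ∘ σ) ≡ true
    from σ h = ∧-intro
      (isIsoᵇ-intro k H (λ _ → true) (adj H) σ record
        { injective = λ i j σij → injective iso i j (trans (≡sym (f₀σ i)) (trans (cong f₀ σij) (f₀σ j)))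
        ; onto      = λ v _ → let i , fi = onto iso (f₀ v) (into iso₀ v) in
                        i , injective iso₀ (σ i) v (trans (f₀σ i) fi)
        ; into      = λ _ → refl
        ; preserves = λ i j → trans (≡sym (preserves iso₀ (σ i) (σ j)))
                        (trans (cong₂ F (f₀σ i) (f₀σ j)) (preserves iso i j))
        })
      (allV-intro k (λ i → =F-intro (≡sym (f₀σ i))))
      where
      f₀σ : ∀ i → f₀ (σ i) ≡ f i
      f₀σ i = trans (cong f₀ (pointwise-=F σ σ₀ h i)) (f₀σ₀ i)
  ... | false = ≡sym (∑-zero (maps k k) (λ σ → cong 𝟙 (not-true (λ h → true≢false (isIsoᵇ-intro n H W F f (composite σ h)) eq))))
    where
    composite : ∀ σ → isAut σ ∧ pointwise _=F_ k f (f₀ ∘ σ) ≡ true → IsIso n H W F f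
    composite σ h = record
      { injective = λ i j fij → injective aut i j (injective iso₀ (σ i) (σ j) (trans (≡sym (f≡ i)) (trans fij (f≡ j))))
      ; onto      = λ v Wv → let j , fj = onto iso₀ v Wv ; i , σi = onto aut j refl in
                      i , trans (f≡ i) (trans (cong f₀ σi) fj)
      ; into      = λ i → trans (cong W (f≡ i)) (into iso₀ (σ i))
      ; preserves = λ i j → trans (cong₂ F (f≡ i) (f≡ j)) (trans (preserves iso₀ (σ i) (σ j)) (preserves aut i j))
      }
      where
      aut = isIsoᵇ-elim k H (λ _ → true) (adj H) σ (proj₁ (∧-elim h))
      f≡ = pointwise-=F f (f₀ ∘ σ) (proj₂ (∧-elim h))

  -- Once a single isomorphism f₀ exists, `isos-torsor` writes all of them as f₀ ∘ σ, and after
  -- exchanging the sums each automorphism σ accounts for one map; if there is none, both sides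
  -- vanish.
  isos-of-copy : ∀ G W F →
    ∑[ f ← maps k n ] 𝟙 (isSubgraph n G W F ∧ isIsoᵇ n H W F f)
    ≡ 𝟙 (isSubgraph n G W F ∧ isoTo n H W F) · automorphisms H
  isos-of-copy G W F with isSubgraph n G W F
  ... | false = ∑-zero (maps k n) (λ _ → refl)
  ... | true with any (isIsoᵇ n H W F) (maps k n) in eq
  ...   | false = ∑𝟙-none (maps k n) eq
  ...   | true  with any-elim (maps k n) eq
  ...     | f₀ , _ , iso₀ = begin
    (∑[ f ← maps k n ] 𝟙 (isIsoᵇ n H W F f))
      ≡⟨ ∑-cong (maps k n) (isos-torsor (isIsoᵇ-elim n H W F f₀ iso₀)) ⟩
    (∑[ f ← maps k n ] ∑[ σ ← maps k k ] 𝟙 (isAut σ ∧ pointwise _=F_ k f (f₀ ∘ σ)))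
      ≡⟨ ∑-swap (maps k n) (maps k k) _ ⟩
    (∑[ σ ← maps k k ] ∑[ f ← maps k n ] 𝟙 (isAut σ ∧ pointwise _=F_ k f (f₀ ∘ σ)))
      ≡⟨ ∑-cong (maps k k) (λ σ → trans (∑-cong (maps k n) (λ f → 𝟙-∧ (isAut σ) _))
           (trans (∑-*ˡ (maps k n) (𝟙 (isAut σ)) _)
           (trans (cong (𝟙 (isAut σ) ·_) (maps-enumerates k n (f₀ ∘ σ))) (ℕₚ.*-identityʳ _)))) ⟩
    automorphisms H
      ≡⟨ ℕₚ.+-identityʳ _ ⟨
    automorphisms H + 0 ∎
    where open ≡-Reasoning

  NH-automorphisms : ∀ G → NH n H G · automorphisms H ≡ embeddings n H G
  NH-automorphisms G = begin
    NH n H G · automorphisms H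
      ≡⟨ cong (_· automorphisms H) (count-× _ (subsets n) (matrices n)) ⟩
    (∑[ W ← subsets n ] ∑[ F ← matrices n ] 𝟙 (isSubgraph n G W F ∧ isoTo n H W F)) · automorphisms H
      ≡⟨ trans (≡sym (∑-*ʳ (subsets n) _ _)) (∑-cong (subsets n) (λ W → ≡sym (∑-*ʳ (matrices n) _ _))) ⟩
    (∑[ W ← subsets n ] ∑[ F ← matrices n ] (𝟙 (isSubgraph n G W F ∧ isoTo n H W F) · automorphisms H))
      ≡⟨ ∑-cong (subsets n) (λ W → trans (∑-cong (matrices n) (λ F → ≡sym (isos-of-copy G W F)))
           (∑-swap (matrices n) (maps k n) _)) ⟩
    (∑[ W ← subsets n ] ∑[ f ← maps k n ] ∑[ F ← matrices n ] 𝟙 (isSubgraph n G W F ∧ isIsoᵇ n H W F f))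
      ≡⟨ ∑-swap (subsets n) (maps k n) _ ⟩
    (∑[ f ← maps k n ] ∑[ W ← subsets n ] ∑[ F ← matrices n ] 𝟙 (isSubgraph n G W F ∧ isIsoᵇ n H W F f))
      ≡⟨ ∑-cong (maps k n) (copies-of-embedding n H G) ⟩
    embeddings n H G ∎
    where open ≡-Reasoning

-- Allows the number of automorphisms to be cancelled. The list of maps contains a map pointwise
-- equal to `id`, which is shown to be an automorphism.
automorphisms>0 : ∀ {k} (H : SimpleGraph k) → 0 < automorphisms H
automorphisms>0 {k} H = subst (_≤ automorphisms H) (maps-enumerates k k id)
  (∑-mono (maps k k) (λ σ → 𝟙-mono (λ h → isIsoᵇ-intro k H (λ _ → true) (adj H) σ (identity (pointwise-=F σ id h)))))
  where
  identity : ∀ {σ : Fin k → Fin k} → (∀ i → σ i ≡ i) → IsIso k H (λ _ → true) (adj H) σ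
  identity σ≡ = record
    { injective = λ i j σij → trans (≡sym (σ≡ i)) (trans σij (σ≡ j))
    ; onto      = λ v _ → v , σ≡ v
    ; into      = λ _ → refl
    ; preserves = λ i j → cong₂ (adj H) (σ≡ i) (σ≡ j)
    }

-- Boolean tests on lists and partitions by them

all-intro : ∀ {p : A → Bool} xs → (∀ {x} → x ∈ xs → p x ≡ true) → all p xs ≡ true
all-intro []       h = refl
all-intro (x ∷ xs) h = ∧-intro (h (here refl)) (all-intro xs (h ∘ there))

all-elim : ∀ (p : A → Bool) {x} xs → all p xs ≡ true → x ∈ xs → p x ≡ true
all-elim p (x ∷ xs) h (here refl) = proj₁ (∧-elim h)
all-elim p (x ∷ xs) h (there x∈)  = all-elim p xs (proj₂ (∧-elim {p x} h)) x∈

split : ∀ (p : A → Bool) xs → ∃₂ λ ys zs →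
  (xs ↭ ys ++ zs) × All (λ x → p x ≡ true) ys × All (λ x → p x ≡ false) zs
split p [] = [] , [] , Perm.refl , [] , []
split p (x ∷ xs) with split p xs | p x in eq
... | ys , zs , π , pys , pzs | true  = x ∷ ys , zs , prep x π , eq ∷ pys , pzs
... | ys , zs , π , pys , pzs | false =
  ys , x ∷ zs , ↭-trans (prep x π) (↭-sym (shift x ys zs)) , pys , eq ∷ pzs

-- Covering a graph by vertex-disjoint stars and isolated vertices

module _ {k} (H : SimpleGraph k) where

  isolated : Fin k → Bool
  isolated u = not (anyV k (adj H u))

  -- Stars must have a leaf: for r = 0 the sum Σ d(v)^r is n, which may exceed the base a + 1 of the
  -- bound, so isolated vertices have a constructor of their own. With `reorder` a list stands for a
  -- vertex set and concatenation for disjoint union.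
  data StarCover : List (Fin k) → Set where
    empty   : StarCover []
    point   : ∀ {u U} → isolated u ≡ true → StarCover U → StarCover (u ∷ U)
    star    : ∀ {c l ls U} → All (λ v → adj H c v ≡ true) (l ∷ ls) → StarCover U → StarCover (c ∷ (l ∷ ls) ++ U)
    reorder : ∀ {U V} → U ↭ V → StarCover U → StarCover V

  adjacent⇒¬isolated : ∀ {u v} → adj H u v ≡ true → isolated u ≡ false
  adjacent⇒¬isolated {u} {v} e = cong not (anyV-intro k v e)

  adj-flip : ∀ {u v} → adj H u v ≡ true → adj H v u ≡ true
  adj-flip {u} {v} e = trans (SimpleGraph.sym H v u) e

  -- Remove an edge vu together with the vertices that become isolated: these are adjacent to
  -- v or to u, so the removed part is one star or two stars, centred at v and u.
  starCover-nonisolated : ∀ m U → length U ≤ m → (∀ {x} → x ∈ U → ∃ λ y → (y ∈ U) × (adj H x y ≡ true)) → StarCover U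
  starCover-nonisolated m       []      _         nbr = empty
  starCover-nonisolated (suc m) (v ∷ U₁) (s≤s len) nbr with nbr (here refl)
  ... | u , here refl , e = ⊥-elim (true≢false e (irrefl H v))
  ... | u , there u∈ , vu with ∈-∃++ u∈
  ... | ys , zs , refl = reorder (↭-sym U↭) cover
    where
    U₂ = ys ++ zs
    U↭ : v ∷ U₁ ↭ v ∷ u ∷ U₂
    U↭ = prep v (shift u ys zs)
    hasNbr : Fin k → Bool
    hasNbr x = any (adj H x) U₂
    parts = split hasNbr U₂
    R = proj₁ parts
    I = proj₁ (proj₂ parts)
    U₂↭ : U₂ ↭ R ++ I
    U₂↭ = proj₁ (proj₂ (proj₂ parts))
    R-has : All (λ x → hasNbr x ≡ true) R
    R-has = proj₁ (proj₂ (proj₂ (proj₂ parts)))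
    I-not : All (λ x → hasNbr x ≡ false) I
    I-not = proj₂ (proj₂ (proj₂ (proj₂ parts)))
    ∈U₂ : ∀ {x} → x ∈ R ++ I → x ∈ U₂
    ∈U₂ = ∈-resp-↭ (↭-sym U₂↭)
    R-nbr : ∀ {x} → x ∈ R → ∃ λ y → (y ∈ R) × (adj H x y ≡ true)
    -- The neighbour `y` found in `U₂` has `x` as a neighbour there, so it cannot have been put into
    -- `I`.
    R-nbr {x} x∈ with any-elim U₂ (lookup R-has x∈)
    ... | y , y∈ , xy with ∈-++⁻ R (∈-resp-↭ U₂↭ y∈)
    ... | inj₁ y∈R = y , y∈R , xy
    ... | inj₂ y∈I = ⊥-elim (true≢false (any-intro U₂ (∈U₂ (∈-++⁺ˡ x∈)) (adj-flip xy)) (lookup I-not y∈I))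
    I-nbr : ∀ {x} → x ∈ I → (adj H v x ≡ true) ⊎ (adj H u x ≡ true)
    I-nbr {x} x∈ with nbr (∈-resp-↭ (↭-sym U↭) (there (there (∈U₂ (∈-++⁺ʳ R x∈)))))
    ... | y , y∈ , xy with ∈-resp-↭ U↭ y∈
    ... | here refl         = inj₁ (adj-flip xy)
    ... | there (here refl) = inj₂ (adj-flip xy)
    ... | there (there y∈U₂) = ⊥-elim (true≢false (any-intro U₂ y∈U₂ xy) (lookup I-not x∈))
    len-R : length R ≤ m
    len-R = begin
      length R          ≤⟨ ℕₚ.m≤m+n (length R) (length I) ⟩
      length R + length I ≡⟨ trans (↭-length U₂↭) (length-++ R) ⟨
      length U₂         ≤⟨ ℕₚ.n≤1+n _ ⟩
      suc (length U₂)   ≡⟨ ↭-length (shift u ys zs) ⟨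
      length U₁         ≤⟨ len ⟩
      m                 ∎
      where open ℕₚ.≤-Reasoning
    cover-R : StarCover R
    cover-R = starCover-nonisolated m R len-R R-nbr
    cover : StarCover (v ∷ u ∷ U₂)
    cover with split (adj H v) I
    ... | Iᵥ , Iᵤ , I↭ , v-Iᵥ , ¬v-Iᵤ = go Iᵥ Iᵤ v-Iᵥ u-Iᵤ U₂↭′
      where
      u-Iᵤ : All (λ x → adj H u x ≡ true) Iᵤ
      u-Iᵤ = All.tabulate λ {x} x∈ → case x∈ (I-nbr (∈-resp-↭ (↭-sym I↭) (∈-++⁺ʳ Iᵥ x∈)))
        where
        case : ∀ {x} → x ∈ Iᵤ → (adj H v x ≡ true) ⊎ (adj H u x ≡ true) → adj H u x ≡ true
        case x∈ (inj₁ vx) = ⊥-elim (true≢false vx (lookup ¬v-Iᵤ x∈))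
        case x∈ (inj₂ ux) = ux
      U₂↭′ : U₂ ↭ Iᵥ ++ Iᵤ ++ R
      U₂↭′ = ↭-trans U₂↭ (↭-trans (++-comm R I) (↭-trans (++⁺ʳ R I↭) (↭-reflexive (++-assoc Iᵥ Iᵤ R))))
      go : ∀ Iᵥ Iᵤ → All (λ x → adj H v x ≡ true) Iᵥ → All (λ x → adj H u x ≡ true) Iᵤ →
           U₂ ↭ Iᵥ ++ Iᵤ ++ R → StarCover (v ∷ u ∷ U₂)
      -- If nothing is left over for `u`, then `u` itself becomes a leaf of `v`, and vice versa; two
      -- stars are formed only when both have leaves of their own.
      go Iᵥ        []        v-Iᵥ u-Iᵤ π = reorder (prep v (prep u (↭-sym π))) (star (vu ∷ v-Iᵥ) cover-R)
      go []        (x ∷ Iᵤ)  v-Iᵥ u-Iᵤ π = reorder (swap u v (↭-sym π)) (star (adj-flip vu ∷ u-Iᵤ) cover-R)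
      go (x ∷ Iᵥ)  (x′ ∷ Iᵤ) v-Iᵥ u-Iᵤ π =
        reorder (prep v (↭-trans (shift u (x ∷ Iᵥ) _) (prep u (↭-sym π)))) (star v-Iᵥ (star u-Iᵤ cover-R))

  starCover : StarCover (allFin k)
  starCover with split isolated (allFin k)
  ... | I , N , π , iso-I , ¬iso-N = reorder (↭-sym π) (points I iso-I)
    where
    N-nbr : ∀ {x} → x ∈ N → ∃ λ y → (y ∈ N) × (adj H x y ≡ true)
    N-nbr {x} x∈ with anyV k (adj H x) in eq | lookup ¬iso-N x∈
    ... | true | _ with anyV-elim k eq
    ... | y , xy with ∈-++⁻ I (∈-resp-↭ π (∈-allFin y))
    ... | inj₁ y∈I = ⊥-elim (true≢false (lookup iso-I y∈I) (adjacent⇒¬isolated (adj-flip xy)))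
    ... | inj₂ y∈N = y , y∈N , xy
    points : ∀ I → All (λ x → isolated x ≡ true) I → StarCover (I ++ N)
    points []      []         = starCover-nonisolated (length N) N ℕₚ.≤-refl N-nbr
    points (x ∷ I) (iso ∷ is) = point iso (points I is)

  -- The number of choices granted to a vertex of `H`; B = a + 1 in the upper bound and B = a in the
  -- lower one.
  weight : (n B : ℕ) → Fin k → ℕ
  weight n B u = if isolated u then n else B

  weight-nonisolated : ∀ n B {u v} → adj H u v ≡ true → weight n B u ≡ B
  weight-nonisolated n B e = cong (λ b → if b then n else B) (adjacent⇒¬isolated e)

  leaves-weight : ∀ n B {c} L → All (λ v → adj H c v ≡ true) L → ∏ L (weight n B) ≡ B ^ length L
  leaves-weight n B []      []        = refl
  leaves-weight n B (l ∷ L) (cl ∷ cL) = cong₂ _·_ (weight-nonisolated n B (adj-flip cl)) (leaves-weight n B L cL)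

-- Summation over all assignments of values to a list of keys

module _ {I X : Set} (xs : List X) where

  assign : List I → (List (I × X) → ℕ) → ℕ
  assign []      Φ = Φ []
  assign (u ∷ U) Φ = ∑[ x ← xs ] assign U (λ P → Φ ((u , x) ∷ P))

  assign-mono : ∀ U {Φ Ψ} → (∀ P → Φ P ≤ Ψ P) → assign U Φ ≤ assign U Ψ
  assign-mono []      Φ≤Ψ = Φ≤Ψ []
  assign-mono (u ∷ U) Φ≤Ψ = ∑-mono xs (λ x → assign-mono U (λ P → Φ≤Ψ ((u , x) ∷ P)))

  assign-cong : ∀ U {Φ Ψ} → (∀ P → Φ P ≡ Ψ P) → assign U Φ ≡ assign U Ψ
  assign-cong []      Φ≡Ψ = Φ≡Ψ []
  assign-cong (u ∷ U) Φ≡Ψ = ∑-cong xs (λ x → assign-cong U (λ P → Φ≡Ψ ((u , x) ∷ P)))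

  assign-*ˡ : ∀ U c Φ → assign U (λ P → c · Φ P) ≡ c · assign U Φ
  assign-*ˡ []      c Φ = refl
  assign-*ˡ (u ∷ U) c Φ = trans (∑-cong xs (λ x → assign-*ˡ U c _)) (∑-*ˡ xs c _)

  -- Exchanging two adjacent keys exchanges two sums; the order of the resulting pairs changes as
  -- well, hence the invariance demanded of `Φ`.
  assign-↭ : ∀ {U V} → U ↭ V → ∀ Φ → (∀ {P Q} → P ↭ Q → Φ P ≡ Φ Q) → assign U Φ ≡ assign V Φ
  assign-↭ Perm.refl        Φ inv = refl
  assign-↭ (prep u π)       Φ inv = ∑-cong xs (λ x → assign-↭ π _ (inv ∘ prep (u , x)))
  assign-↭ {v ∷ u ∷ U} {_ ∷ _ ∷ V} (swap v u π) Φ inv = trans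
    (∑-cong xs (λ x → ∑-cong xs (λ y → trans (assign-↭ π _ (λ ρ → inv (prep (v , x) (prep (u , y) ρ))))
      (assign-cong V (λ P → inv (swap (v , x) (u , y) Perm.refl))))))
    (∑-swap xs xs _)
  assign-↭ (Perm.trans π ρ) Φ inv = trans (assign-↭ π Φ inv) (assign-↭ ρ Φ inv)

map-allFin-suc : ∀ {A : Set} k (h : Fin (suc k) → A) → map h (allFin (suc k)) ≡ h zero ∷ map (h ∘ suc) (allFin k)
map-allFin-suc k h = trans (cong (map h) (allFin-suc k)) (cong (h zero ∷_) (≡sym (map-∘ (allFin k))))

-- The labelling `g` serves the induction, in which the tail of `allFin (suc k)` appears as the
-- image of `allFin k` under `suc`.
∑-maps≡assign : ∀ {I : Set} k n (g : Fin k → I) Ψ →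
  ∑[ f ← maps k n ] Ψ (map (λ i → g i , f i) (allFin k)) ≡ assign (allFin n) (map g (allFin k)) Ψ
∑-maps≡assign zero    n g Ψ = ℕₚ.+-identityʳ _
∑-maps≡assign (suc k) n g Ψ = begin
  (∑[ f ← maps (suc k) n ] Ψ (map (λ i → g i , f i) (allFin (suc k))))
    ≡⟨ ∑-enum-suc (allFin n) k _ ⟩
  (∑[ f ← maps k n ] ∑[ x ← allFin n ] Ψ (map (λ i → g i , (x VF.∷ f) i) (allFin (suc k))))
    ≡⟨ ∑-swap (maps k n) (allFin n) _ ⟩
  (∑[ x ← allFin n ] ∑[ f ← maps k n ] Ψ (map (λ i → g i , (x VF.∷ f) i) (allFin (suc k))))
    ≡⟨ ∑-cong (allFin n) (λ x → trans (∑-cong (maps k n) (λ f → cong Ψ (map-allFin-suc k _)))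
         (∑-maps≡assign k n (g ∘ suc) (λ P → Ψ ((g zero , x) ∷ P)))) ⟩
  assign (allFin n) (g zero ∷ map (g ∘ suc) (allFin k)) Ψ
    ≡⟨ cong (λ U → assign (allFin n) U Ψ) (map-allFin-suc k g) ⟨
  assign (allFin n) (map g (allFin (suc k))) Ψ ∎
  where open ≡-Reasoning

-- Bounding homomorphisms by a star cover

module _ {k n} (H : SimpleGraph k) (G : Adj n) where

  respectsEdge : Fin k × Fin n → Fin k × Fin n → Bool
  respectsEdge (i , x) (j , y) = adj H i j ⇒ᵇ G x y

  -- Testing all ordered pairs makes the condition independent of the order of the list and lets it
  -- pass to sublists.
  consistent : List (Fin k × Fin n) → Bool
  consistent P = all (λ p → all (respectsEdge p) P) P

  consistent-elim : ∀ P → consistent P ≡ true → ∀ {p q} → p ∈ P → q ∈ P → respectsEdge p q ≡ true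
  consistent-elim P h {p} p∈ q∈ = all-elim (respectsEdge p) P (all-elim (λ p → all (respectsEdge p) P) P h p∈) q∈

  consistent-intro : ∀ P → (∀ {p q} → p ∈ P → q ∈ P → respectsEdge p q ≡ true) → consistent P ≡ true
  consistent-intro P h = all-intro P (λ p∈ → all-intro P (λ q∈ → h p∈ q∈))

  consistent-⊆ : ∀ P Q → (∀ {p} → p ∈ Q → p ∈ P) → consistent P ≡ true → consistent Q ≡ true
  consistent-⊆ P Q Q⊆P h = consistent-intro Q (λ p∈ q∈ → consistent-elim P h (Q⊆P p∈) (Q⊆P q∈))

  consistent-↭ : ∀ {P Q} → P ↭ Q → 𝟙 (consistent P) ≡ 𝟙 (consistent Q)
  consistent-↭ {P} {Q} π = cong 𝟙 (bool-ext (consistent-⊆ P Q (∈-resp-↭ (↭-sym π))) (consistent-⊆ Q P (∈-resp-↭ π)))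

  -- For a list without repetitions, the number of homomorphisms to `G` from the subgraph of `H`
  -- induced by `U`. Injectivity is given up so that the stars of a cover can be placed
  -- independently.
  homsOn : List (Fin k) → ℕ
  homsOn U = assign (allFin n) U (𝟙 ∘ consistent)

  embeddings≤homsOn : embeddings n H G ≤ homsOn (allFin k)
  embeddings≤homsOn = begin
    embeddings n H G
      ≤⟨ ∑-mono (maps k n) (λ f → 𝟙-mono (λ h → consistent-intro _ (graph-consistent f h))) ⟩
    (∑[ f ← maps k n ] 𝟙 (consistent (map (λ i → i , f i) (allFin k))))
      ≡⟨ ∑-maps≡assign k n id _ ⟩
    homsOn (map id (allFin k))
      ≡⟨ cong homsOn (map-id (allFin k)) ⟩
    homsOn (allFin k) ∎
    where
    open ℕₚ.≤-Reasoning
    graph-consistent : ∀ f → isEmbeddingᵇ n H G f ≡ true →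
      ∀ {p q} → p ∈ map (λ i → i , f i) (allFin k) → q ∈ map (λ i → i , f i) (allFin k) → respectsEdge p q ≡ true
    graph-consistent f h p∈ q∈ with ∈-map⁻ _ p∈ | ∈-map⁻ _ q∈
    ... | i , _ , refl | j , _ , refl = allV-elim k (allV-elim k (proj₂ (∧-elim {injectiveᵇ f} h)) i) j

  module _ (G-sym : ∀ x y → G x y ≡ G y x) (G-irrefl : ∀ x → G x x ≡ false) where
    open StarSums G G-sym G-irrefl

    -- With the image x of the centre fixed, only the edge to the centre is retained for each leaf,
    -- which leaves deg x choices; after the last leaf the centre is forgotten too.
    homsOn-leaves : ∀ c x L U → All (λ v → adj H c v ≡ true) L →
      assign (allFin n) (L ++ U) (λ P → 𝟙 (consistent ((c , x) ∷ P))) ≤ deg x (allFin n) ^ length L · homsOn U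
    homsOn-leaves c x []      U []        = ℕₚ.≤-trans
      (assign-mono (allFin n) U (λ P → 𝟙-mono (consistent-⊆ ((c , x) ∷ P) P there)))
      (ℕₚ.≤-reflexive (≡sym (ℕₚ.+-identityʳ (homsOn U))))
    homsOn-leaves c x (l ∷ L) U (cl ∷ cL) = begin
      (∑[ y ← allFin n ] assign (allFin n) (L ++ U) (λ P → 𝟙 (consistent ((c , x) ∷ (l , y) ∷ P))))
        ≤⟨ ∑-mono (allFin n) (λ y → assign-mono (allFin n) (L ++ U) (drop-leaf y)) ⟩
      (∑[ y ← allFin n ] assign (allFin n) (L ++ U) (λ P → 𝟙 (G x y) · 𝟙 (consistent ((c , x) ∷ P))))
        ≡⟨ trans (∑-cong (allFin n) (λ y → assign-*ˡ (allFin n) (L ++ U) (𝟙 (G x y)) _)) (∑-*ʳ (allFin n) _ _) ⟩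
      deg x (allFin n) · assign (allFin n) (L ++ U) (λ P → 𝟙 (consistent ((c , x) ∷ P)))
        ≤⟨ ℕₚ.*-monoʳ-≤ (deg x (allFin n)) (homsOn-leaves c x L U cL) ⟩
      deg x (allFin n) · (deg x (allFin n) ^ length L · homsOn U)
        ≡⟨ ℕₚ.*-assoc (deg x (allFin n)) _ _ ⟨
      deg x (allFin n) ^ length (l ∷ L) · homsOn U ∎
      where
      open ℕₚ.≤-Reasoning
      drop-leaf : ∀ y P → 𝟙 (consistent ((c , x) ∷ (l , y) ∷ P)) ≤ 𝟙 (G x y) · 𝟙 (consistent ((c , x) ∷ P))
      drop-leaf y P = ℕₚ.≤-trans (𝟙-mono (λ h → ∧-intro
        (⇒ᵇ-elim (consistent-elim ((c , x) ∷ (l , y) ∷ P) h (here refl) (there (here refl))) cl)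
        (consistent-⊆ ((c , x) ∷ (l , y) ∷ P) ((c , x) ∷ P) skip h)))
        (ℕₚ.≤-reflexive (𝟙-∧ (G x y) _))
        where
        skip : ∀ {p} → p ∈ (c , x) ∷ P → p ∈ (c , x) ∷ (l , y) ∷ P
        skip (here refl) = here refl
        skip (there p∈)  = there (there p∈)

    homsOn-star : ∀ c L U → All (λ v → adj H c v ≡ true) L →
      homsOn (c ∷ L ++ U) ≤ starSum (length L) (allFin n) · homsOn U
    homsOn-star c L U cL = subst (homsOn (c ∷ L ++ U) ≤_) (∑-*ʳ (allFin n) _ _)
      (∑-mono (allFin n) (λ x → homsOn-leaves c x L U cL))

    homsOn-point : ∀ u U → homsOn (u ∷ U) ≤ n · homsOn U
    homsOn-point u U = subst (homsOn (u ∷ U) ≤_)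
      (trans (∑-const (allFin n) _) (cong (_· homsOn U) (length-tabulate {n = n} id)))
      (∑-mono (allFin n) (λ x → assign-mono (allFin n) U (λ P → 𝟙-mono (consistent-⊆ ((u , x) ∷ P) P there))))

    module _ (B : ℕ) (starBound : ∀ r → suc r ≤ k → starSum (suc r) (allFin n) ≤ B ^ suc (suc r)) where

      private
        w = weight H n B

      -- A star with r leaves costs B^(r+1), one factor `B` for each of its vertices, none of them
      -- isolated. The pieces therefore multiply to a product over vertices in which the cover is no
      -- longer visible.
      homsOn≤∏ : ∀ {U} → StarCover H U → length U ≤ k → homsOn U ≤ ∏ U w
      homsOn≤∏ empty _ = ℕₚ.≤-refl
      homsOn≤∏ {u ∷ U} (point iso cov) len = begin
        homsOn (u ∷ U)      ≤⟨ homsOn-point u U ⟩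
        n · homsOn U        ≤⟨ ℕₚ.*-monoʳ-≤ n (homsOn≤∏ cov (ℕₚ.≤-trans (ℕₚ.n≤1+n _) len)) ⟩
        n · ∏ U w      ≡⟨ cong (λ b → (if b then n else B) · ∏ U w) iso ⟨
        ∏ (u ∷ U) w    ∎
        where open ℕₚ.≤-Reasoning
      homsOn≤∏ (star {c} {l} {ls} {U} (cl ∷ cL) cov) len = begin
        homsOn (c ∷ (l ∷ ls) ++ U)
          ≤⟨ homsOn-star c (l ∷ ls) U (cl ∷ cL) ⟩
        starSum (suc (length ls)) (allFin n) · homsOn U
          ≤⟨ ℕₚ.*-mono-≤ (starBound (length ls) (ℕₚ.≤-trans (ℕₚ.n≤1+n _) (ℕₚ.m+n≤o⇒m≤o _ len′))) (homsOn≤∏ cov (ℕₚ.m+n≤o⇒n≤o _ len′)) ⟩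
        B ^ suc (length (l ∷ ls)) · ∏ U w
          ≡⟨ cong₂ (λ b p → b · p · ∏ U w) (≡sym (weight-nonisolated H n B cl)) (≡sym (leaves-weight H n B (l ∷ ls) (cl ∷ cL))) ⟩
        w c · ∏ (l ∷ ls) w · ∏ U w
          ≡⟨ ∏-++ (c ∷ l ∷ ls) U w ⟨
        ∏ (c ∷ (l ∷ ls) ++ U) w ∎
        where
        open ℕₚ.≤-Reasoning
        len′ : suc (suc (length ls)) + length U ≤ k
        len′ = subst (_≤ k) (length-++ (c ∷ l ∷ ls)) len
      homsOn≤∏ (reorder {U} {V} π cov) len = begin
        homsOn V      ≡⟨ assign-↭ (allFin n) π _ consistent-↭ ⟨
        homsOn U      ≤⟨ homsOn≤∏ cov (subst (_≤ k) (≡sym (↭-length π)) len) ⟩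
        ∏ U w    ≡⟨ ∏-↭ π w ⟩
        ∏ V w    ∎
        where open ℕₚ.≤-Reasoning

      embeddings≤∏weight : embeddings n H G ≤ ∏ (allFin k) w
      embeddings≤∏weight = ℕₚ.≤-trans embeddings≤homsOn
        (homsOn≤∏ (starCover H) (ℕₚ.≤-reflexive (length-tabulate id)))

-- Boolean comparison of numbers, sums of indices, binomial coefficients

≡ᵇ-intro : ∀ {m n} → m ≡ n → (m ≡ᵇ n) ≡ true
≡ᵇ-intro {m} {n} eq = Equivalence.to T-≡ (ℕₚ.≡⇒≡ᵇ m n eq)

≡ᵇ-elim : ∀ {m n} → (m ≡ᵇ n) ≡ true → m ≡ n
≡ᵇ-elim {m} {n} eq = ℕₚ.≡ᵇ⇒≡ m n (Equivalence.from T-≡ eq)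

<ᵇ-intro : ∀ {m n} → m < n → (m <ᵇ n) ≡ true
<ᵇ-intro m<n = Equivalence.to T-≡ (ℕₚ.<⇒<ᵇ m<n)

<ᵇ-elim : ∀ {m n} → (m <ᵇ n) ≡ true → m < n
<ᵇ-elim {m} {n} eq = ℕₚ.<ᵇ⇒< m n (Equivalence.from T-≡ eq)

≢⇒≡ᵇ-false : ∀ {m n} → m ≢ n → (m ≡ᵇ n) ≡ false
≢⇒≡ᵇ-false m≢n = not-true (m≢n ∘ ≡ᵇ-elim)

≤⇒<ᵇ-false : ∀ {m n} → n ≤ m → (m <ᵇ n) ≡ false
≤⇒<ᵇ-false {m} {n} n≤m = not-true (λ h → ℕₚ.<⇒≱ (<ᵇ-elim {m} {n} h) n≤m)

≡ᵇ-sym : ∀ m n → (m ≡ᵇ n) ≡ (n ≡ᵇ m)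
≡ᵇ-sym m n = bool-ext (λ h → ≡ᵇ-intro (≡sym (≡ᵇ-elim {m} {n} h))) (λ h → ≡ᵇ-intro (≡sym (≡ᵇ-elim {n} {m} h)))

∈⇒≤∑ : ∀ {x} (xs : List A) f → x ∈ xs → f x ≤ ∑ xs f
∈⇒≤∑ (x ∷ xs) f (here refl) = ℕₚ.m≤m+n (f x) _
∈⇒≤∑ (x ∷ xs) f (there x∈)  = ℕₚ.≤-trans (∈⇒≤∑ xs f x∈) (ℕₚ.m≤n+m _ (f x))

∑-below : ∀ n m → m ≤ n → ∑[ i ← allFin n ] 𝟙 (toℕ i <ᵇ m) ≡ m
∑-below n       zero    _         = ∑-zero (allFin n) (λ _ → refl)
∑-below (suc n) (suc m) (s≤s m≤n) = trans (∑-allFin-suc n (λ i → 𝟙 (toℕ i <ᵇ suc m))) (cong suc (∑-below n m m≤n))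

suc-C-2 : ∀ n → suc n C 2 ≡ n + n C 2
suc-C-2 n = trans (≡sym (nCk+nC[k+1]≡[n+1]C[k+1] n 1)) (cong (_+ n C 2) (nC1≡n n))

2·suc-C-2 : ∀ n → 2 · (suc n C 2) ≡ suc n · n
2·suc-C-2 zero    = refl
2·suc-C-2 (suc n) = begin
  2 · (suc (suc n) C 2)        ≡⟨ cong (2 ·_) (suc-C-2 (suc n)) ⟩
  2 · (suc n + suc n C 2)      ≡⟨ ℕₚ.*-distribˡ-+ 2 (suc n) _ ⟩
  2 · suc n + 2 · (suc n C 2)  ≡⟨ cong (2 · suc n +_) (2·suc-C-2 n) ⟩
  2 · suc n + suc n · n        ≡⟨ lemma n ⟩
  suc (suc n) · suc n          ∎
  where
  open ≡-Reasoning
  lemma : ∀ n → 2 · suc n + suc n · n ≡ suc (suc n) · suc n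
  lemma = solve-∀

-- The shift `s` is for the induction: splitting off vertex 0 lowers the index of every other vertex
-- by one.
∑-below-shifted : ∀ n a s → a ≤ n → ∑[ j ← allFin n ] (𝟙 (toℕ j <ᵇ a) · (s + toℕ j)) ≡ a · s + a C 2
∑-below-shifted n       zero    s _         = ∑-zero (allFin n) (λ _ → refl)
∑-below-shifted (suc n) (suc a) s (s≤s a≤n) = begin
  (∑[ j ← allFin (suc n) ] (𝟙 (toℕ j <ᵇ suc a) · (s + toℕ j)))
    ≡⟨ ∑-allFin-suc n (λ j → 𝟙 (toℕ j <ᵇ suc a) · (s + toℕ j)) ⟩
  1 · (s + 0) + (∑[ j ← allFin n ] (𝟙 (toℕ j <ᵇ a) · (s + suc (toℕ j))))
    ≡⟨ cong (1 · (s + 0) +_) (∑-cong (allFin n) (λ j → cong (𝟙 (toℕ j <ᵇ a) ·_) (ℕₚ.+-suc s (toℕ j)))) ⟩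
  1 · (s + 0) + (∑[ j ← allFin n ] (𝟙 (toℕ j <ᵇ a) · (suc s + toℕ j)))
    ≡⟨ cong (1 · (s + 0) +_) (∑-below-shifted n a (suc s) a≤n) ⟩
  1 · (s + 0) + (a · suc s + a C 2)
    ≡⟨ lemma s a (a C 2) ⟩
  suc a · s + (a + a C 2)
    ≡⟨ cong (suc a · s +_) (suc-C-2 a) ⟨
  suc a · s + suc a C 2 ∎
  where
  open ≡-Reasoning
  lemma : ∀ s a c → 1 · (s + 0) + (a · suc s + c) ≡ suc a · s + (a + c)
  lemma = solve-∀

-- Quasi-cliques

edges≡∑ : ∀ n (G : Adj n) → edges n G ≡ ∑[ j ← allFin n ] ∑[ i ← allFin n ] 𝟙 ((toℕ i <ᵇ toℕ j) ∧ G i j)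
edges≡∑ n G = trans (count-× _ (allFin n) (allFin n)) (∑-swap (allFin n) (allFin n) _)

edges-cong : ∀ n {G G′ : Adj n} → (∀ i j → G i j ≡ G′ i j) → edges n G ≡ edges n G′
edges-cong n {G} {G′} G≡G′ = trans (edges≡∑ n G) (trans
  (∑-cong (allFin n) (λ j → ∑-cong (allFin n) (λ i → cong (λ b → 𝟙 ((toℕ i <ᵇ toℕ j) ∧ b)) (G≡G′ i j))))
  (≡sym (edges≡∑ n G′)))

quasiClique-sym : ∀ n a b i j → quasiClique n a b i j ≡ quasiClique n a b j i
quasiClique-sym n a b i j = cong₂ _∧_ (cong not (≡ᵇ-sym (toℕ i) (toℕ j)))
  (cong₂ _∨_ (∧-comm (toℕ i <ᵇ a) (toℕ j <ᵇ a)) (∨-comm ((toℕ j ≡ᵇ a) ∧ (toℕ i <ᵇ b)) ((toℕ i ≡ᵇ a) ∧ (toℕ j <ᵇ b))))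

quasiClique-irrefl : ∀ n a b i → quasiClique n a b i i ≡ false
quasiClique-irrefl n a b i rewrite =F-refl i = refl

-- Each edge is attributed to its larger endpoint j: for j < a it is a clique edge, for j = a it
-- joins the extra vertex to one of its b neighbours, which are smaller because b < a.
quasiClique-edge : ∀ n a b → b < a → ∀ i j →
  𝟙 ((toℕ i <ᵇ toℕ j) ∧ quasiClique n a b i j)
  ≡ 𝟙 (toℕ i <ᵇ toℕ j) · 𝟙 (toℕ j <ᵇ a) + 𝟙 (toℕ i <ᵇ b) · 𝟙 (toℕ j ≡ᵇ a)
quasiClique-edge n a b b<a i j = go (toℕ i) (toℕ j)
  where
  go : ∀ x y → 𝟙 ((x <ᵇ y) ∧ (not (x ≡ᵇ y) ∧ (((x <ᵇ a) ∧ (y <ᵇ a)) ∨ ((y ≡ᵇ a) ∧ (x <ᵇ b)) ∨ ((x ≡ᵇ a) ∧ (y <ᵇ b)))))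
             ≡ 𝟙 (x <ᵇ y) · 𝟙 (y <ᵇ a) + 𝟙 (x <ᵇ b) · 𝟙 (y ≡ᵇ a)
  go x y with ℕₚ.<-cmp x y | ℕₚ.<-cmp y a
  go x y | tri< x<y x≢y _ | tri< y<a y≢a _
    rewrite <ᵇ-intro x<y | ≢⇒≡ᵇ-false x≢y | <ᵇ-intro (ℕₚ.<-trans x<y y<a) | <ᵇ-intro y<a | ≢⇒≡ᵇ-false y≢a
    = cong suc (≡sym (ℕₚ.*-zeroʳ (𝟙 (x <ᵇ b))))
  go x y | tri< x<y x≢y _ | tri≈ _ refl _
    rewrite <ᵇ-intro x<y | ≢⇒≡ᵇ-false x≢y | ≤⇒<ᵇ-false (ℕₚ.≤-refl {y}) | ≡ᵇ-intro {y} refl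
    with x <ᵇ b
  ... | true  = refl
  ... | false = refl
  go x y | tri< x<y x≢y _ | tri> _ y≢a a<y
    rewrite <ᵇ-intro x<y | ≢⇒≡ᵇ-false x≢y | ≤⇒<ᵇ-false (ℕₚ.<⇒≤ a<y) | ≢⇒≡ᵇ-false y≢a | ≤⇒<ᵇ-false (ℕₚ.<⇒≤ (ℕₚ.<-trans b<a a<y))
          | ∧-comm (x <ᵇ a) false | ∧-comm (x ≡ᵇ a) false
    = ≡sym (ℕₚ.*-zeroʳ (𝟙 (x <ᵇ b)))
  go x y | tri≈ _ refl _ | tri≈ _ refl _ rewrite ≤⇒<ᵇ-false (ℕₚ.≤-refl {x}) | ≤⇒<ᵇ-false (ℕₚ.<⇒≤ b<a) = refl
  go x y | tri≈ _ refl _ | tri< _ y≢a _ rewrite ≤⇒<ᵇ-false (ℕₚ.≤-refl {x}) | ≢⇒≡ᵇ-false y≢a = ≡sym (ℕₚ.*-zeroʳ (𝟙 (x <ᵇ b)))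
  go x y | tri≈ _ refl _ | tri> _ y≢a _ rewrite ≤⇒<ᵇ-false (ℕₚ.≤-refl {x}) | ≢⇒≡ᵇ-false y≢a = ≡sym (ℕₚ.*-zeroʳ (𝟙 (x <ᵇ b)))
  go x y | tri> _ _ y<x | tri< _ y≢a _ rewrite ≤⇒<ᵇ-false (ℕₚ.<⇒≤ y<x) | ≢⇒≡ᵇ-false y≢a = ≡sym (ℕₚ.*-zeroʳ (𝟙 (x <ᵇ b)))
  go x y | tri> _ _ y<x | tri> _ y≢a _ rewrite ≤⇒<ᵇ-false (ℕₚ.<⇒≤ y<x) | ≢⇒≡ᵇ-false y≢a = ≡sym (ℕₚ.*-zeroʳ (𝟙 (x <ᵇ b)))
  go x y | tri> _ _ y<x | tri≈ _ refl _ rewrite ≤⇒<ᵇ-false (ℕₚ.<⇒≤ y<x) | ≤⇒<ᵇ-false (ℕₚ.<⇒≤ (ℕₚ.<-trans b<a y<x)) = refl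

-- The extra vertex is the one numbered a. It exists only if a < n, and for a = n there must be no
-- edge left for it.
quasiClique-edges : ∀ n a b → b < a → a ≤ n → (a < n) ⊎ (b ≡ 0) → edges n (quasiClique n a b) ≡ (a C 2) + b
quasiClique-edges n a b b<a a≤n a<n⊎b≡0 = begin
  edges n (quasiClique n a b)
    ≡⟨ edges≡∑ n (quasiClique n a b) ⟩
  (∑[ j ← allFin n ] ∑[ i ← allFin n ] 𝟙 ((toℕ i <ᵇ toℕ j) ∧ quasiClique n a b i j))
    ≡⟨ ∑-cong (allFin n) (λ j → trans (∑-cong (allFin n) (λ i → quasiClique-edge n a b b<a i j))
        (trans (∑-+ (allFin n) _ _) (cong₂ _+_ (below j) (apex j)))) ⟩
  (∑[ j ← allFin n ] (𝟙 (toℕ j <ᵇ a) · (0 + toℕ j) + 𝟙 (toℕ j ≡ᵇ a) · b))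
    ≡⟨ ∑-+ (allFin n) _ _ ⟩
  (∑[ j ← allFin n ] (𝟙 (toℕ j <ᵇ a) · (0 + toℕ j))) + (∑[ j ← allFin n ] (𝟙 (toℕ j ≡ᵇ a) · b))
    ≡⟨ cong₂ _+_ (trans (∑-below-shifted n a 0 a≤n) (cong (_+ a C 2) (ℕₚ.*-zeroʳ a)))
                 (trans (∑-*ʳ (allFin n) _ b) (apexes a<n⊎b≡0)) ⟩
  (a C 2) + b ∎
  where
  open ≡-Reasoning
  below : ∀ j → ∑[ i ← allFin n ] (𝟙 (toℕ i <ᵇ toℕ j) · 𝟙 (toℕ j <ᵇ a)) ≡ 𝟙 (toℕ j <ᵇ a) · (0 + toℕ j)
  below j = trans (∑-*ʳ (allFin n) _ _)
    (trans (cong (_· 𝟙 (toℕ j <ᵇ a)) (∑-below n (toℕ j) (ℕₚ.<⇒≤ (toℕ<n j)))) (ℕₚ.*-comm (toℕ j) _))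
  apex : ∀ j → ∑[ i ← allFin n ] (𝟙 (toℕ i <ᵇ b) · 𝟙 (toℕ j ≡ᵇ a)) ≡ 𝟙 (toℕ j ≡ᵇ a) · b
  apex j = trans (∑-*ʳ (allFin n) _ _)
    (trans (cong (_· 𝟙 (toℕ j ≡ᵇ a)) (∑-below n b (ℕₚ.<⇒≤ (ℕₚ.<-≤-trans b<a a≤n)))) (ℕₚ.*-comm b _))
  apexes : (a < n) ⊎ (b ≡ 0) → (∑[ j ← allFin n ] 𝟙 (toℕ j ≡ᵇ a)) · b ≡ b
  apexes (inj₁ a<n)  = trans (cong (_· b) (trans
    (∑-cong (allFin n) (λ j → cong (λ x → 𝟙 (toℕ j ≡ᵇ x)) (≡sym (toℕ-fromℕ< a<n))))
    (allFin-enumerates n (fromℕ< a<n)))) (ℕₚ.*-identityˡ b)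
  apexes (inj₂ refl) = ℕₚ.*-zeroʳ (∑[ j ← allFin n ] 𝟙 (toℕ j ≡ᵇ a))

-- If a exceeded n, the clique alone would have at least C(n+1,2) = C(n,2) + n edges, too many since
-- n > 0. Hence the quasi-clique fits on n vertices.
C2-bound : ∀ n a b → 0 < n → b < a → (a C 2) + b ≤ n C 2 → (a ≤ n) × ((a < n) ⊎ (b ≡ 0))
C2-bound n a b 0<n b<a e≤ with ℕₚ.<-cmp a n
... | tri< a<n _ _ = ℕₚ.<⇒≤ a<n , inj₁ a<n
... | tri≈ _ refl _ = ℕₚ.≤-refl , inj₂ (ℕₚ.n≤0⇒n≡0 (ℕₚ.+-cancelˡ-≤ (a C 2) b 0 (subst ((a C 2) + b ≤_) (≡sym (ℕₚ.+-identityʳ _)) e≤)))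
C2-bound n (suc a) b 0<n b<a e≤ | tri> _ _ (s≤s n≤a) = ⊥-elim (ℕₚ.<⇒≱ 0<n (ℕₚ.+-cancelʳ-≤ (n C 2) n 0 (begin
  n + n C 2         ≡⟨ suc-C-2 n ⟨
  suc n C 2         ≤⟨ ℕₚ.*-cancelˡ-≤ 2 (subst₂ _≤_ (≡sym (2·suc-C-2 n)) (≡sym (2·suc-C-2 a)) (ℕₚ.*-mono-≤ (s≤s n≤a) n≤a)) ⟩
  suc a C 2         ≤⟨ ℕₚ.m≤m+n _ b ⟩
  (suc a C 2) + b   ≤⟨ e≤ ⟩
  n C 2             ∎)))
  where open ℕₚ.≤-Reasoning

module _ {n} (G : Adj n) (G-sym : ∀ x y → G x y ≡ G y x) (G-irrefl : ∀ x → G x x ≡ false) where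
  open StarSums G G-sym G-irrefl

  handshake : degreeSum (allFin n) ≡ 2 · edges n G
  handshake = begin
    (∑[ i ← allFin n ] ∑[ j ← allFin n ] 𝟙 (G i j))
      ≡⟨ ∑-cong (allFin n) (λ i → trans (∑-cong (allFin n) (orient i)) (∑-+ (allFin n) _ _)) ⟩
    (∑[ i ← allFin n ] ((∑[ j ← allFin n ] 𝟙 ((toℕ j <ᵇ toℕ i) ∧ G j i)) + (∑[ j ← allFin n ] 𝟙 ((toℕ i <ᵇ toℕ j) ∧ G i j))))
      ≡⟨ ∑-+ (allFin n) _ _ ⟩
    (∑[ i ← allFin n ] ∑[ j ← allFin n ] 𝟙 ((toℕ j <ᵇ toℕ i) ∧ G j i)) + (∑[ i ← allFin n ] ∑[ j ← allFin n ] 𝟙 ((toℕ i <ᵇ toℕ j) ∧ G i j))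
      ≡⟨ cong₂ _+_ (≡sym (edges≡∑ n G)) (trans (∑-swap (allFin n) (allFin n) _) (≡sym (edges≡∑ n G))) ⟩
    edges n G + edges n G
      ≡⟨ cong (edges n G +_) (ℕₚ.+-identityʳ _) ⟨
    2 · edges n G ∎
    where
    open ≡-Reasoning
    orient : ∀ i j → 𝟙 (G i j) ≡ 𝟙 ((toℕ j <ᵇ toℕ i) ∧ G j i) + 𝟙 ((toℕ i <ᵇ toℕ j) ∧ G i j)
    orient i j with ℕₚ.<-cmp (toℕ i) (toℕ j)
    ... | tri< i<j _ _ rewrite <ᵇ-intro i<j | ≤⇒<ᵇ-false (ℕₚ.<⇒≤ i<j) = refl
    ... | tri> _ _ j<i rewrite <ᵇ-intro j<i | ≤⇒<ᵇ-false (ℕₚ.<⇒≤ j<i) | G-sym i j = ≡sym (ℕₚ.+-identityʳ _)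
    ... | tri≈ _ i≡j _ with toℕ-injective i≡j
    ... | refl rewrite ≤⇒<ᵇ-false (ℕₚ.≤-refl {toℕ i}) | G-irrefl i = refl

-- Counting injective maps below prescribed thresholds

fits : ∀ {k n} → (Fin k → ℕ) → (Fin k → Fin n) → Bool
fits {k} b f = injectiveᵇ f ∧ allV k (λ i → toℕ (f i) <ᵇ b i)

-- A value x below its bound either extends `f` or collides with some `f i`. Summed over x, the
-- collisions number k.
fits-extend : ∀ {k n} (b : Fin (suc k) → ℕ) (f : Fin k → Fin n) x → fits (b ∘ suc) f ≡ true →
  𝟙 (toℕ x <ᵇ b zero) ≤ 𝟙 (fits b (x VF.∷ f)) + (∑[ i ← allFin k ] 𝟙 (x =F f i))
fits-extend {k} b f x fit = go _ _ refl refl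
  where
  hits : Fin k → Bool
  hits i = x =F f i
  go : ∀ c h → (toℕ x <ᵇ b zero) ≡ c → any hits (allFin k) ≡ h →
    𝟙 c ≤ 𝟙 (fits b (x VF.∷ f)) + (∑[ i ← allFin k ] 𝟙 (hits i))
  go false h    x< hit = z≤n
  go true true  x< hit with any-elim (allFin k) hit
  ... | i , i∈ , eq = ℕₚ.≤-trans (subst (λ c → 1 ≤ 𝟙 c) (≡sym eq) ℕₚ.≤-refl)
                        (ℕₚ.≤-trans (∈⇒≤∑ (allFin k) (𝟙 ∘ hits) i∈) (ℕₚ.m≤n+m _ _))
  go true false x< hit = ℕₚ.≤-trans
    (ℕₚ.≤-reflexive (cong 𝟙 (≡sym (∧-intro (injectiveᵇ-intro (x VF.∷ f) inj) (allV-intro (suc k) below)))))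
    (ℕₚ.m≤m+n _ _)
    where
    fit′ = ∧-elim {injectiveᵇ f} fit
    miss : ∀ i → x ≢ f i
    miss i eq = true≢false (any-intro (allFin k) (∈-allFin i) (=F-intro eq)) hit
    inj : ∀ i j → (x VF.∷ f) i ≡ (x VF.∷ f) j → i ≡ j
    inj zero    zero    _  = refl
    inj zero    (suc j) eq = ⊥-elim (miss j eq)
    inj (suc i) zero    eq = ⊥-elim (miss i (≡sym eq))
    inj (suc i) (suc j) eq = cong suc (injectiveᵇ-elim f (proj₁ fit′) i j eq)
    below : ∀ i → (toℕ ((x VF.∷ f) i) <ᵇ b i) ≡ true
    below zero    = x<
    below (suc i) = allV-elim k (proj₂ fit′) i

-- Greedy choice: each new value has to avoid the earlier ones. A fixed subtrahend `s`, at least the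
-- number of coordinates, keeps the product the same throughout the induction.
∏≤fits : ∀ k n s (b : Fin k → ℕ) → k ≤ s → (∀ i → b i ≤ n) →
  ∏[ i ← allFin k ] (b i ∸ s) ≤ ∑[ f ← maps k n ] 𝟙 (fits b f)
∏≤fits zero    n s b _   b≤n = ℕₚ.≤-refl
∏≤fits (suc k) n s b k<s b≤n = begin
  (∏[ i ← allFin (suc k) ] (b i ∸ s))
    ≡⟨ ∏-allFin-suc k (λ i → b i ∸ s) ⟩
  (b zero ∸ s) · (∏[ i ← allFin k ] (b (suc i) ∸ s))
    ≤⟨ ℕₚ.*-monoʳ-≤ (b zero ∸ s) (∏≤fits k n s (b ∘ suc) (ℕₚ.<⇒≤ k<s) (b≤n ∘ suc)) ⟩
  (b zero ∸ s) · (∑[ f ← maps k n ] 𝟙 (fits (b ∘ suc) f))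
    ≡⟨ ∑-*ˡ (maps k n) (b zero ∸ s) _ ⟨
  (∑[ f ← maps k n ] ((b zero ∸ s) · 𝟙 (fits (b ∘ suc) f)))
    ≤⟨ ∑-mono (maps k n) extend ⟩
  (∑[ f ← maps k n ] ∑[ x ← allFin n ] 𝟙 (fits b (x VF.∷ f)))
    ≡⟨ ∑-enum-suc (allFin n) k _ ⟨
  (∑[ f ← maps (suc k) n ] 𝟙 (fits b f)) ∎
  where
  open ℕₚ.≤-Reasoning
  extend : ∀ f → (b zero ∸ s) · 𝟙 (fits (b ∘ suc) f) ≤ ∑[ x ← allFin n ] 𝟙 (fits b (x VF.∷ f))
  extend f with fits (b ∘ suc) f in fit
  ... | false = ℕₚ.≤-trans (ℕₚ.≤-reflexive (ℕₚ.*-zeroʳ (b zero ∸ s))) z≤n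
  ... | true  = begin
    (b zero ∸ s) · 1 ≡⟨ ℕₚ.*-identityʳ _ ⟩
    b zero ∸ s       ≤⟨ ℕₚ.∸-monoʳ-≤ (b zero) (ℕₚ.<⇒≤ k<s) ⟩
    b zero ∸ k       ≤⟨ ℕₚ.m≤n+o⇒m∸n≤o _ k total ⟩
    (∑[ x ← allFin n ] 𝟙 (fits b (x VF.∷ f))) ∎
    where
    total : b zero ≤ k + (∑[ x ← allFin n ] 𝟙 (fits b (x VF.∷ f)))
    total = begin
      b zero
        ≡⟨ ∑-below n (b zero) (b≤n zero) ⟨
      (∑[ x ← allFin n ] 𝟙 (toℕ x <ᵇ b zero))
        ≤⟨ ∑-mono (allFin n) (λ x → fits-extend b f x fit) ⟩
      (∑[ x ← allFin n ] (𝟙 (fits b (x VF.∷ f)) + (∑[ i ← allFin k ] 𝟙 (x =F f i))))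
        ≡⟨ ∑-+ (allFin n) _ _ ⟩
      fitting + (∑[ x ← allFin n ] ∑[ i ← allFin k ] 𝟙 (x =F f i))
        ≡⟨ cong (fitting +_) (trans (∑-swap (allFin n) (allFin k) _)
             (trans (∑-cong (allFin k) (λ i → allFin-enumerates n (f i))) (∑-const (allFin k) 1))) ⟩
      fitting + length (allFin k) · 1
        ≡⟨ cong (fitting +_) (trans (ℕₚ.*-identityʳ _) (length-tabulate {n = k} id)) ⟩
      fitting + k
        ≡⟨ ℕₚ.+-comm fitting k ⟩
      k + fitting ∎
      where
      fitting = ∑[ x ← allFin n ] 𝟙 (fits b (x VF.∷ f))

module _ {k} (n a b : ℕ) (H : SimpleGraph k) where

  -- With `weight` as bounds, `fits` sends the non-isolated vertices of `H` into the clique on 0,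
  -- ..., a - 1, where distinct vertices are adjacent, and the isolated ones anywhere.
  ∏≤embeddings-quasiClique : a ≤ n → ∏[ i ← allFin k ] (weight H n a i ∸ k) ≤ embeddings n H (quasiClique n a b)
  ∏≤embeddings-quasiClique a≤n = ℕₚ.≤-trans (∏≤fits k n k (weight H n a) ℕₚ.≤-refl bound≤n)
    (∑-mono (maps k n) (λ f → 𝟙-mono (embeds f)))
    where
    bound≤n : ∀ i → weight H n a i ≤ n
    bound≤n i with isolated H i
    ... | true  = ℕₚ.≤-refl
    ... | false = a≤n
    embeds : ∀ f → fits (weight H n a) f ≡ true → isEmbeddingᵇ n H (quasiClique n a b) f ≡ true
    embeds f fit = ∧-intro (proj₁ fit′) (allV-intro k (λ i → allV-intro k (λ j → ⇒ᵇ-intro (edge i j))))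
      where
      fit′ = ∧-elim {injectiveᵇ f} fit
      inClique : ∀ i j → adj H i j ≡ true → (toℕ (f i) <ᵇ a) ≡ true
      inClique i j e = subst (λ c → (toℕ (f i) <ᵇ (if c then n else a)) ≡ true) (adjacent⇒¬isolated H e)
        (allV-elim k (proj₂ fit′) i)
      edge : ∀ i j → adj H i j ≡ true → quasiClique n a b (f i) (f j) ≡ true
      edge i j e rewrite inClique i j e | inClique j i (adj-flip H e) = ∧-intro (cong not (not-true distinct)) refl
        where
        distinct : (f i =F f j) ≢ true
        distinct eq with injectiveᵇ-elim f (proj₁ fit′) i j (=F-elim eq)
        ... | refl = true≢false e (irrefl H i)

-- Extremal numbers

foldr-⊔-upper : ∀ (c m : ℕ) (p : A → Bool) (f : A → ℕ) xs → (∀ x → p x ≡ true → c · f x ≤ m) →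
  c · foldr _⊔_ 0 (map f (filterᵇ p xs)) ≤ m
foldr-⊔-upper c m p f []       h = ℕₚ.≤-trans (ℕₚ.≤-reflexive (ℕₚ.*-zeroʳ c)) z≤n
foldr-⊔-upper c m p f (x ∷ xs) h with p x in px
... | false = foldr-⊔-upper c m p f xs h
... | true  = ℕₚ.≤-trans (ℕₚ.≤-reflexive (ℕₚ.*-distribˡ-⊔ c (f x) _)) (ℕₚ.⊔-lub (h x px) (foldr-⊔-upper c m p f xs h))

foldr-⊔-lower : ∀ (p : A → Bool) (f : A → ℕ) xs {x} → x ∈ xs → p x ≡ true → f x ≤ foldr _⊔_ 0 (map f (filterᵇ p xs))
foldr-⊔-lower p f (x ∷ xs) (here refl) px rewrite px = ℕₚ.m≤m⊔n (f x) _
foldr-⊔-lower p f (y ∷ xs) (there x∈)  px with p y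
... | false = foldr-⊔-lower p f xs x∈ px
... | true  = ℕₚ.≤-trans (foldr-⊔-lower p f xs x∈ px) (ℕₚ.m≤n⊔m (f y) _)

module _ {k} (n : ℕ) (H : SimpleGraph k) where

  embeddings-cong : ∀ {G G′ : Adj n} → (∀ i j → G i j ≡ G′ i j) → embeddings n H G ≡ embeddings n H G′
  embeddings-cong {G} {G′} G≡G′ = ℕₚ.≤-antisym (half G≡G′) (half (λ i j → ≡sym (G≡G′ i j)))
    where
    half : ∀ {G G′ : Adj n} → (∀ i j → G i j ≡ G′ i j) → embeddings n H G ≤ embeddings n H G′
    half G≡G′ = ∑-mono (maps k n) (λ f → 𝟙-mono (λ h →
      let inj , hom = ∧-elim {injectiveᵇ f} h in
      ∧-intro inj (allV-intro k (λ i → allV-intro k (λ j → ⇒ᵇ-intro (λ e →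
        trans (≡sym (G≡G′ (f i) (f j))) (⇒ᵇ-elim (allV-elim k (allV-elim k hom i) j) e)))))))

  -- Reached through `embeddings`, where entrywise equality is easy to use. It lets a graph be
  -- replaced by the entrywise equal matrix found in `matrices`.
  NH-cong : ∀ {G G′ : Adj n} → (∀ i j → G i j ≡ G′ i j) → NH n H G ≡ NH n H G′
  NH-cong {G} {G′} G≡G′ = ℕₚ.*-cancelʳ-≡ _ _ (automorphisms H) {{ℕ.>-nonZero (automorphisms>0 H)}}
    (trans (NH-automorphisms n H G) (trans (embeddings-cong G≡G′) (≡sym (NH-automorphisms n H G′))))

  ex-lower : ∀ e (G : Adj n) → (∀ i j → G i j ≡ G j i) → (∀ i → G i i ≡ false) → edges n G ≡ e → NH n H G ≤ ex n e H
  ex-lower e G G-sym G-irrefl edges≡ with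
    ∑𝟙-some (matrices n) (ℕₚ.≤-reflexive (≡sym (matrices-enumerates n G)))
  ... | G₀ , G₀∈ , G₀≈G = subst (_≤ ex n e H) (NH-cong G₀≡G)
    (foldr-⊔-lower (λ G → isSimple n G ∧ (edges n G ≡ᵇ e)) (NH n H) (matrices n) G₀∈
      (∧-intro
        (isSimple-intro n H G₀ (λ i j → trans (G₀≡G i j) (trans (G-sym i j) (≡sym (G₀≡G j i)))) (λ i → trans (G₀≡G i i) (G-irrefl i)))
        (≡ᵇ-intro (trans (edges-cong n G₀≡G) edges≡))))
    where
    G₀≡G = pointwise-matrix G₀ G G₀≈G

  ex-upper : ∀ c m e → (∀ G → (∀ i j → G i j ≡ G j i) → (∀ i → G i i ≡ false) → edges n G ≡ e → c · NH n H G ≤ m) →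
    c · ex n e H ≤ m
  ex-upper c m e h = foldr-⊔-upper c m (λ G → isSimple n G ∧ (edges n G ≡ᵇ e)) (NH n H) (matrices n) (λ G pG →
    let simple , edges≡ = ∧-elim {isSimple n G} pG ; G-sym , G-irrefl = isSimple-elim n H G simple in
    h G G-sym G-irrefl (≡ᵇ-elim edges≡))

-- Comparison of the two bounds

-- By the tangent at y + t, the excess of (y + t)^k over y^k is at most k·t·(y + t)^(k-1), hence at
-- most the (Q + 1)-th part of (y + t)^k.
power-ratio : ∀ Q k y t → suc Q · k · t ≤ y + t → Q · (y + t) ^ k ≤ suc Q · y ^ k
power-ratio Q zero    y t _    = ℕₚ.*-monoˡ-≤ 1 (ℕₚ.n≤1+n Q)
power-ratio Q (suc k) y t large =
  ≤-cancel (ℕₚ.+-mono-≤ (ℕₚ.*-monoʳ-≤ (suc Q) (^-upper k y t)) (ℕₚ.*-monoˡ-≤ ((y + t) ^ k) large))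
           (lemma Q (y + t) ((y + t) ^ k) (y ^ suc k) k t)
  where
  lemma : ∀ Q s p z k t → Q · (s · p) + (suc Q · (z + suc k · t · p) + s · p) + 0
    ≡ suc Q · z + (suc Q · (s · p) + suc Q · suc k · t · p)
  lemma = solve-∀

-- The quotient x/(x - k) decreases in x, so an isolated vertex, with n choices, loses no larger a
-- proportion than a clique vertex with a.
cross-ratio : ∀ k a n → k ≤ a → a ≤ n → n · (a ∸ k) ≤ suc a · (n ∸ k)
cross-ratio k a n k≤a a≤n = subst₂ (λ a n → n · y ≤ suc a · (n ∸ k)) k+y (trans (cong (_+ t) k+y) (ℕₚ.m+[n∸m]≡n a≤n))
  (subst (λ z → (k + y + t) · y ≤ suc (k + y) · z) (≡sym (trans (cong (_∸ k) (ℕₚ.+-assoc k y t)) (ℕₚ.m+n∸m≡n k (y + t))))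
    (≤-cancel (z≤n {0}) (lemma k y t)))
  where
  y = a ∸ k
  t = n ∸ a
  k+y : k + y ≡ a
  k+y = ℕₚ.m+[n∸m]≡n k≤a
  lemma : ∀ k y t → (k + y + t) · y + 0 + (k · t + y + t) ≡ suc (k + y) · (y + t) + 0
  lemma = solve-∀

-- As b ≤ a - 1, the left side is at most a(a - 1) + 2(a - 1). This is why `suc a` serves as the
-- base `B`.
2·edges≤² : ∀ a b → b < a → 2 · ((a C 2) + b) ≤ suc a · suc a
2·edges≤² (suc a) b (s≤s b≤a) = ≤-cancel (ℕₚ.+-mono-≤ (ℕₚ.≤-reflexive (2·suc-C-2 a)) (ℕₚ.*-monoʳ-≤ 2 b≤a))
  (lemma (suc a C 2) b a)
  where
  lemma : ∀ c b a → 2 · (c + b) + (suc a · a + 2 · a) + (a + 4) ≡ suc (suc a) · suc (suc a) + (2 · c + 2 · b)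
  lemma = solve-∀

module _ {k} (H : SimpleGraph k) where

  -- Compared factor by factor, every vertex of `H` loses at most the quotient (a + 1)/(a - k),
  -- isolated or not, so the number of isolated vertices drops out.
  ∏weight-ratio : ∀ n a → k ≤ a → a ≤ n →
    ∏ (allFin k) (weight H n (suc a)) · (a ∸ k) ^ k ≤ suc a ^ k · (∏[ i ← allFin k ] (weight H n a i ∸ k))
  ∏weight-ratio n a k≤a a≤n = begin
    ∏ (allFin k) (weight H n (suc a)) · (a ∸ k) ^ k
      ≡⟨ cong (∏ (allFin k) (weight H n (suc a)) ·_) (const (a ∸ k)) ⟨
    ∏ (allFin k) (weight H n (suc a)) · ∏ (allFin k) (λ _ → a ∸ k)
      ≡⟨ ∏-* (allFin k) _ _ ⟨
    (∏[ i ← allFin k ] (weight H n (suc a) i · (a ∸ k)))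
      ≤⟨ ∏-mono (allFin k) ratio ⟩
    (∏[ i ← allFin k ] (suc a · (weight H n a i ∸ k)))
      ≡⟨ ∏-* (allFin k) _ _ ⟩
    ∏ (allFin k) (λ _ → suc a) · (∏[ i ← allFin k ] (weight H n a i ∸ k))
      ≡⟨ cong (_· (∏[ i ← allFin k ] (weight H n a i ∸ k))) (const (suc a)) ⟩
    suc a ^ k · (∏[ i ← allFin k ] (weight H n a i ∸ k)) ∎
    where
    open ℕₚ.≤-Reasoning
    const : ∀ c → ∏ (allFin k) (λ _ → c) ≡ c ^ k
    const c = trans (∏-const (allFin k) c) (cong (c ^_) (length-tabulate {n = k} id))
    ratio : ∀ i → weight H n (suc a) i · (a ∸ k) ≤ suc a · (weight H n a i ∸ k)
    ratio i with isolated H i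
    ... | true  = cross-ratio k a n k≤a a≤n
    ... | false = ℕₚ.≤-refl

  -- Quotients are cleared by the number of automorphisms and by (a - k)^k, both positive and
  -- cancelled first. The condition with `suc Q · k · suc k` is that of `power-ratio` for the gap k
  -- + 1 between a - k and a + 1.
  copies≤quasiClique : ∀ Q n a b → b < a → a ≤ n → Dense (threshold k) n (2 · ((a C 2) + b)) →
    suc Q · k · suc k ≤ suc a → k < a →
    ∀ (G : Adj n) → (∀ i j → G i j ≡ G j i) → (∀ i → G i i ≡ false) → edges n G ≡ (a C 2) + b →
    Q · NH n H G ≤ suc Q · NH n H (quasiClique n a b)
  copies≤quasiClique Q n a b b<a a≤n dense large k<a G G-sym G-irrefl edges≡ =
    ℕₚ.*-cancelʳ-≤ _ _ (automorphisms H) {{ℕ.>-nonZero (automorphisms>0 H)}}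
    (ℕₚ.*-cancelʳ-≤ _ _ (y ^ k) {{ℕₚ.m^n≢0 y k {{ℕ.>-nonZero (ℕₚ.m<n⇒0<n∸m k<a)}}}} (begin
      Q · NH n H G · aut · y ^ k
        ≡⟨ cong (_· y ^ k) (trans (ℕₚ.*-assoc Q _ _) (cong (Q ·_) (NH-automorphisms n H G))) ⟩
      Q · embeddings n H G · y ^ k
        ≤⟨ ℕₚ.*-monoˡ-≤ (y ^ k) (ℕₚ.*-monoʳ-≤ Q (embeddings≤∏weight H G G-sym G-irrefl (suc a) starBound)) ⟩
      Q · ∏ (allFin k) (weight H n (suc a)) · y ^ k
        ≡⟨ ℕₚ.*-assoc Q _ _ ⟩
      Q · (∏ (allFin k) (weight H n (suc a)) · y ^ k)
        ≤⟨ ℕₚ.*-monoʳ-≤ Q (∏weight-ratio n a (ℕₚ.<⇒≤ k<a) a≤n) ⟩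
      Q · (suc a ^ k · (∏[ i ← allFin k ] (weight H n a i ∸ k)))
        ≤⟨ ℕₚ.*-monoʳ-≤ Q (ℕₚ.*-monoʳ-≤ (suc a ^ k) (∏≤embeddings-quasiClique n a b H a≤n)) ⟩
      Q · (suc a ^ k · embeddings n H K)
        ≡⟨ ℕₚ.*-assoc Q _ _ ⟨
      Q · suc a ^ k · embeddings n H K
        ≤⟨ ℕₚ.*-monoˡ-≤ (embeddings n H K) powers ⟩
      suc Q · y ^ k · embeddings n H K
        ≡⟨ cong (suc Q · y ^ k ·_) (NH-automorphisms n H K) ⟨
      suc Q · y ^ k · (NH n H K · aut)
        ≡⟨ rearrange (suc Q) (y ^ k) (NH n H K) aut ⟩
      suc Q · NH n H K · aut · y ^ k ∎))
    where
    open ℕₚ.≤-Reasoning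
    open StarSums G G-sym G-irrefl
    K = quasiClique n a b
    aut = automorphisms H
    y = a ∸ k
    rearrange : ∀ q p m t → q · p · (m · t) ≡ q · m · t · p
    rearrange = solve-∀
    y+k : y + suc k ≡ suc a
    y+k = trans (ℕₚ.+-suc y k) (cong suc (ℕₚ.m∸n+n≡m (ℕₚ.<⇒≤ k<a)))
    powers : Q · suc a ^ k ≤ suc Q · y ^ k
    powers = subst (λ x → Q · x ^ k ≤ suc Q · y ^ k) y+k
      (power-ratio Q k y (suc k) (subst (suc Q · k · suc k ≤_) (≡sym y+k) large))
    degreeSum≡ : degreeSum (allFin n) ≡ 2 · ((a C 2) + b)
    degreeSum≡ = trans (handshake G G-sym G-irrefl) (cong (2 ·_) edges≡)
    degreeSum≤² : degreeSum (allFin n) ≤ suc a · suc a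
    degreeSum≤² = subst (_≤ suc a · suc a) (≡sym degreeSum≡) (2·edges≤² a b b<a)
    starBound : ∀ r → suc r ≤ k → starSum (suc r) (allFin n) ≤ suc a ^ suc (suc r)
    starBound r r<k = starSum≤^ r (allFin n) (suc a) (threshold-mono r<k)
      (subst₂ (Dense (threshold k)) (≡sym (length-tabulate {n = n} id)) (≡sym degreeSum≡) dense) degreeSum≤²

-- Rational arithmetic

toℚᵘ-ℕtoℚ : ∀ m → toℚᵘ (ℕtoℚ m) ℚᵘ.≃ mkℚᵘ (+ᶻ m) 0
toℚᵘ-ℕtoℚ m = ℚₚ.toℚᵘ-fromℚᵘ (mkℚᵘ (+ᶻ m) 0)

ℕtoℚ-mono : ∀ {x y} → x ≤ y → ℕtoℚ x ≤ℚ ℕtoℚ y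
ℕtoℚ-mono {x} {y} x≤y = ℚₚ.toℚᵘ-cancel-≤ (begin
  toℚᵘ (ℕtoℚ x) ≃⟨ toℚᵘ-ℕtoℚ x ⟩
  mkℚᵘ (+ᶻ x) 0  ≤⟨ *≤* (ℤₚ.*-monoʳ-≤-nonNeg (+ᶻ 1) (+≤+ x≤y)) ⟩
  mkℚᵘ (+ᶻ y) 0  ≃⟨ toℚᵘ-ℕtoℚ y ⟨
  toℚᵘ (ℕtoℚ y) ∎)
  where open ℚᵘₚ.≤-Reasoning

fraction-* : ∀ p d x → toℚᵘ (fromℚᵘ (mkℚᵘ (+ᶻ p) d) * ℕtoℚ x) ℚᵘ.≃ mkℚᵘ (+ᶻ (p · x)) d
fraction-* p d x = begin
  toℚᵘ (fromℚᵘ (mkℚᵘ (+ᶻ p) d) * ℕtoℚ x)               ≈⟨ ℚₚ.toℚᵘ-homo-* (fromℚᵘ (mkℚᵘ (+ᶻ p) d)) (ℕtoℚ x) ⟩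
  toℚᵘ (fromℚᵘ (mkℚᵘ (+ᶻ p) d)) ℚᵘ.* toℚᵘ (ℕtoℚ x)     ≈⟨ ℚᵘₚ.*-cong (ℚₚ.toℚᵘ-fromℚᵘ (mkℚᵘ (+ᶻ p) d)) (toℚᵘ-ℕtoℚ x) ⟩
  mkℚᵘ (+ᶻ p) d ℚᵘ.* mkℚᵘ (+ᶻ x) 0                      ≈⟨ ℚᵘ.*≡* (cong₂ ℤ._*_ (≡sym (ℤₚ.pos-* p x)) (cong +ᶻ_ (≡sym (ℕₚ.*-identityʳ (suc d))))) ⟩
  mkℚᵘ (+ᶻ (p · x)) d                                  ∎
  where open ℚᵘₚ.≃-Reasoning

fraction-≤-elim : ∀ p d x y → fromℚᵘ (mkℚᵘ (+ᶻ p) d) * ℕtoℚ x ≤ℚ ℕtoℚ y → p · x ≤ suc d · y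
fraction-≤-elim p d x y h with ℚᵘₚ.≤-respˡ-≃ (fraction-* p d x) (ℚᵘₚ.≤-respʳ-≃ (toℚᵘ-ℕtoℚ y) (ℚₚ.toℚᵘ-mono-≤ h))
... | *≤* le = ℤₚ.drop‿+≤+ (subst₂ ℤ._≤_ (ℤₚ.*-identityʳ (+ᶻ (p · x)))
  (trans (≡sym (ℤₚ.pos-* y (suc d))) (cong +ᶻ_ (ℕₚ.*-comm y (suc d)))) le)

fraction-≤-intro : ∀ p d x y → suc d · x ≤ p · y → ℕtoℚ x ≤ℚ fromℚᵘ (mkℚᵘ (+ᶻ p) d) * ℕtoℚ y
fraction-≤-intro p d x y h = ℚₚ.toℚᵘ-cancel-≤
  (ℚᵘₚ.≤-respˡ-≃ (ℚᵘₚ.≃-sym (toℚᵘ-ℕtoℚ x)) (ℚᵘₚ.≤-respʳ-≃ (ℚᵘₚ.≃-sym (fraction-* p d y))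
    (*≤* (subst₂ ℤ._≤_ (trans (cong +ᶻ_ (ℕₚ.*-comm (suc d) x)) (ℤₚ.pos-* x (suc d)))
      (≡sym (ℤₚ.*-identityʳ (+ᶻ (p · y)))) (+≤+ h)))))

instance
  ℕtoℚ-nonNegative : ∀ {m} → ℚ.NonNegative (ℕtoℚ m)
  ℕtoℚ-nonNegative {m} = ℚ.nonNegative (ℕtoℚ-mono {0} {m} z≤n)

-- A positive rational with denominator d + 1 is at least 1/(d + 1), so the ratio (d + 2)/(d + 1)
-- suffices.
≤-[1+ε]* : ∀ p d .(c : Coprime (suc p) (suc d)) x y → let ε = ℚ.mkℚ (+ᶻ suc p) d c in
  suc d · x ≤ suc (suc d) · y → ℕtoℚ x ≤ℚ (1ℚ +ℚ ε) * ℕtoℚ y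
≤-[1+ε]* p d c x y h = ℚₚ.≤-trans (fraction-≤-intro (suc (suc d)) d x y h)
  (ℚₚ.*-monoʳ-≤-nonNeg (ℕtoℚ y) {{ℕtoℚ-nonNegative {y}}} 1+1/d≤1+ε)
  where
  ε = ℚ.mkℚ (+ᶻ suc p) d c
  1+1/d≤1+ε : fromℚᵘ (mkℚᵘ (+ᶻ suc (suc d)) d) ≤ℚ 1ℚ +ℚ ε
  1+1/d≤1+ε = ℚₚ.toℚᵘ-cancel-≤
    (ℚᵘₚ.≤-respˡ-≃ (ℚᵘₚ.≃-sym (ℚₚ.toℚᵘ-fromℚᵘ (mkℚᵘ (+ᶻ suc (suc d)) d)))
    (ℚᵘₚ.≤-respʳ-≃ (ℚᵘₚ.≃-sym (ℚₚ.toℚᵘ-homo-+ 1ℚ ε))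
      (*≤* (+≤+ (≤-cancel (z≤n {0}) (lemma p d))))))
    where
    lemma : ∀ p d → suc (suc d) · (1 · suc d) + 0 + p · suc d ≡ (1 · suc d + suc p · 1) · suc d + 0
    lemma = solve-∀

[1-ε]*≤ : ∀ {ε x y} → 0ℚ <ℚ ε → x ≤ y → (1ℚ - ε) * ℕtoℚ x ≤ℚ ℕtoℚ y
[1-ε]*≤ {ε} {x} {y} 0<ε x≤y = begin
  (1ℚ - ε) * ℕtoℚ x  ≤⟨ ℚₚ.*-monoʳ-≤-nonNeg (ℕtoℚ x) {{ℕtoℚ-nonNegative {x}}} (ℚₚ.+-monoʳ-≤ 1ℚ (ℚₚ.neg-antimono-≤ (ℚₚ.<⇒≤ 0<ε))) ⟩
  1ℚ * ℕtoℚ x        ≡⟨ ℚₚ.*-identityˡ (ℕtoℚ x) ⟩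
  ℕtoℚ x             ≤⟨ ℕtoℚ-mono x≤y ⟩
  ℕtoℚ y             ∎
  where open ℚₚ.≤-Reasoning

-- Large n

-- The hypothesis compares `E` with n(n - 1), but `Dense` compares it with n². The deficit is at
-- most n²/(2t + 2) from the ratio plus n from the diagonal, and for n > 2t each part, times t,
-- stays below n²/2.
dense-ratio : ∀ t m E → suc (2 · t) · (suc m · m) ≤ suc (suc (2 · t)) · E → 2 · t ≤ m → Dense t (suc m) E
dense-ratio t m E dense large = ℕₚ.*-cancelˡ-≤ (suc (suc (2 · t)))
  (≤-cancel (ℕₚ.+-mono-≤ (ℕₚ.*-monoʳ-≤ t dense) (ℕₚ.*-monoʳ-≤ ((2 + t) · suc m) (ℕₚ.≤-trans large (ℕₚ.n≤1+n m)))) (lemma t m E))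
  where
  lemma : ∀ t m E → let n = suc m in
    suc (suc (2 · t)) · (t · (n · n)) + (t · (suc (suc (2 · t)) · E) + (2 + t) · n · n) + 3 · t · n
    ≡ suc (suc (2 · t)) · (n · n + t · E) + (t · (suc (2 · t) · (n · m)) + (2 + t) · n · (2 · t))
  lemma = solve-∀

-- The ratio is at least 1/2, whence (a + 1)² ≥ E ≥ m²/2 ≥ 2L².
large-clique : ∀ t m a E L → suc (2 · t) · (suc m · m) ≤ suc (suc (2 · t)) · E → E ≤ suc a · suc a → 2 · L ≤ m → L ≤ suc a
large-clique t m a E L dense E≤ large = ²-cancel-≤ (ℕₚ.*-cancelˡ-≤ 2 (begin
  2 · (L · L)             ≤⟨ ≤-cancel (ℕₚ.*-mono-≤ large large) (lemma₁ L m) ⟩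
  m · m                   ≤⟨ ℕₚ.*-cancelˡ-≤ (suc (suc (2 · t))) (≤-cancel (ℕₚ.*-monoʳ-≤ 2 dense) (lemma₂ t m E)) ⟩
  2 · E                   ≤⟨ ℕₚ.*-monoʳ-≤ 2 E≤ ⟩
  2 · (suc a · suc a)     ∎))
  where
  open ℕₚ.≤-Reasoning
  lemma₁ : ∀ L m → 2 · (L · L) + m · m + 2 · (L · L) ≡ m · m + 2 · L · (2 · L)
  lemma₁ = solve-∀
  lemma₂ : ∀ t m E → suc (suc (2 · t)) · (m · m) + 2 · (suc (suc (2 · t)) · E) + (2 · t · (m · m) + 2 · suc (2 · t) · m)
    ≡ suc (suc (2 · t)) · (2 · E) + 2 · (suc (2 · t) · (suc m · m))
  lemma₂ = solve-∀

theorem1p2 : ∀ {k} (H : SimpleGraph k) →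
    Σ ℚ λ c → (0ℚ <ℚ c) × (c <ℚ 1ℚ) ×
    ((ε : ℚ) → 0ℚ <ℚ ε → Σ ℕ λ n₀ → (n a b : ℕ) → n₀ ≤ n → b < a →
    c * ℕtoℚ (n C 2) ≤ℚ ℕtoℚ ((a C 2) + b) → (a C 2) + b ≤ n C 2 →
    ((1ℚ - ε) * ℕtoℚ (NH n H (quasiClique n a b)) ≤ℚ ℕtoℚ (ex n ((a C 2) + b) H))
    × (ℕtoℚ (ex n ((a C 2) + b) H) ≤ℚ (1ℚ +ℚ ε) * ℕtoℚ (NH n H (quasiClique n a b))))
theorem1p2 {k} H = c , 0<c , c<1 , asymptotic
  where
  t = threshold k
  -- The second argument is the denominator minus one, so c = 1 - 1/(2t + 2). This is closer to 1
  -- than 1 - 1/t, leaving room for the passage from n(n - 1) to n² in `dense-ratio`.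
  cᵘ = mkℚᵘ (+ᶻ suc (2 · t)) (suc (2 · t))
  c = fromℚᵘ cᵘ
  0<c : 0ℚ <ℚ c
  0<c = ℚₚ.toℚᵘ-cancel-< (ℚᵘₚ.<-respʳ-≃ (ℚᵘₚ.≃-sym (ℚₚ.toℚᵘ-fromℚᵘ cᵘ)) (*<* (+<+ (s≤s z≤n))))
  c<1 : c <ℚ 1ℚ
  c<1 = ℚₚ.toℚᵘ-cancel-< (ℚᵘₚ.<-respˡ-≃ (ℚᵘₚ.≃-sym (ℚₚ.toℚᵘ-fromℚᵘ cᵘ)) (*<* (+<+ (≤-cancel (z≤n {0}) (lemma t)))))
    where
    lemma : ∀ t → suc (suc (2 · t) · 1) + 0 + 0 ≡ 1 · suc (suc (2 · t)) + 0
    lemma = solve-∀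
  asymptotic : (ε : ℚ) → 0ℚ <ℚ ε → Σ ℕ λ n₀ → (n a b : ℕ) → n₀ ≤ n → b < a →
    c * ℕtoℚ (n C 2) ≤ℚ ℕtoℚ ((a C 2) + b) → (a C 2) + b ≤ n C 2 →
    ((1ℚ - ε) * ℕtoℚ (NH n H (quasiClique n a b)) ≤ℚ ℕtoℚ (ex n ((a C 2) + b) H))
    × (ℕtoℚ (ex n ((a C 2) + b) H) ≤ℚ (1ℚ +ℚ ε) * ℕtoℚ (NH n H (quasiClique n a b)))
  asymptotic (ℚ.mkℚ (+ᶻ zero) d _)  (ℚ.*<* (+<+ ()))
  asymptotic (ℚ.mkℚ -[1+ _ ] d _)  (ℚ.*<* ())
  -- The leading `suc` gives n = suc m with 2L ≤ m and 2t ≤ m, as `large-clique` and `dense-ratio`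
  -- require.
  asymptotic (ℚ.mkℚ (+ᶻ suc p) d coprime) 0<ε = suc (2 · L + 2 · t) , bounds
    where
    ε = ℚ.mkℚ (+ᶻ suc p) d coprime
    Q = suc d
    -- L ≤ a + 1 yields two things: the first summand brings (a + 1)^k within a factor 1 + 1/Q of (a
    -- - k)^k, the second gives k < a.
    L = suc Q · k · suc k + suc (suc k)
    bounds : (n a b : ℕ) → suc (2 · L + 2 · t) ≤ n → b < a →
      c * ℕtoℚ (n C 2) ≤ℚ ℕtoℚ ((a C 2) + b) → (a C 2) + b ≤ n C 2 →
      ((1ℚ - ε) * ℕtoℚ (NH n H (quasiClique n a b)) ≤ℚ ℕtoℚ (ex n ((a C 2) + b) H))
      × (ℕtoℚ (ex n ((a C 2) + b) H) ≤ℚ (1ℚ +ℚ ε) * ℕtoℚ (NH n H (quasiClique n a b)))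
    bounds (suc m) a b (s≤s n₀≤m) b<a hyp e≤ =
      -- The quasi-clique is itself among the graphs over which `ex` takes the maximum.
      [1-ε]*≤ 0<ε (ex-lower n H e K (quasiClique-sym n a b) (quasiClique-irrefl n a b) (quasiClique-edges n a b b<a a≤n a<n⊎b≡0)) ,
      ≤-[1+ε]* p d coprime (ex n e H) (NH n H K) (ex-upper n H Q (suc Q · NH n H K) e
        (copies≤quasiClique H Q n a b b<a a≤n (dense-ratio t m (2 · e) dense (ℕₚ.≤-trans (ℕₚ.m≤n+m (2 · t) (2 · L)) n₀≤m))
          (ℕₚ.m+n≤o⇒m≤o (suc Q · k · suc k) L≤) (ℕₚ.≤-pred (ℕₚ.m+n≤o⇒n≤o (suc Q · k · suc k) L≤))))
      where
      n = suc m
      e = (a C 2) + b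
      K = quasiClique n a b
      a≤n = proj₁ (C2-bound n a b (s≤s z≤n) b<a e≤)
      a<n⊎b≡0 = proj₂ (C2-bound n a b (s≤s z≤n) b<a e≤)
      dense : suc (2 · t) · (n · m) ≤ suc (suc (2 · t)) · (2 · e)
      dense = begin
        suc (2 · t) · (n · m)           ≡⟨ cong (suc (2 · t) ·_) (2·suc-C-2 m) ⟨
        suc (2 · t) · (2 · (n C 2))     ≡⟨ commute (suc (2 · t)) (n C 2) ⟩
        2 · (suc (2 · t) · (n C 2))     ≤⟨ ℕₚ.*-monoʳ-≤ 2 (fraction-≤-elim (suc (2 · t)) (suc (2 · t)) (n C 2) e hyp) ⟩
        2 · (suc (suc (2 · t)) · e)     ≡⟨ commute (suc (suc (2 · t))) e ⟨
        suc (suc (2 · t)) · (2 · e)     ∎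
        where
        open ℕₚ.≤-Reasoning
        commute : ∀ x y → x · (2 · y) ≡ 2 · (x · y)
        commute = solve-∀
      L≤ : L ≤ suc a
      L≤ = large-clique t m a (2 · e) L dense (2·edges≤² a b b<a) (ℕₚ.≤-trans (ℕₚ.m≤m+n (2 · L) (2 · t)) n₀≤m)
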